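{- Let $d\ge 2$ and $\omega>2$ be fixed integers independent of $n$. There is a polynomial time approximation scheme for the Maximum Independent Set problem in $d$-dimensional Line of Sight networks with range parameter $\omega$ (presented with their embedding in $\mathbb{Z}^d_n$): for every fixed $\epsilon>0$ there is an algorithm running in time polynomial in $n$ that, on any such network, returns a $(1+\epsilon)$-approximation.
   Context: $\mathbb{Z}^d_n=\{1,\dots,n\}^d$. Two distinct points share a line of sight if their coordinates differ in exactly one place. A vertex-weighted graph $G=(V,E,w)$ (positive weights) is a $d$-dimensional Line of Sight (LoS) network with range parameter $\omega$ if there is an embedding (injective map) $f_G:V\to\mathbb{Z}^d_n$ such that $\{u,v\}\in E$ if and only if $f_G(u)$ and $f_G(v)$ share a line of sight and their Manhattan distance is less than $\omega$. The Maximum Independent Set (MIS) problem asks for an independent set maximizing the sum of the weights of its elements. A $(1+\epsilon)$-approximation is an independent set whose total weight is at least $1/(1+\epsilon)$ times the optimum.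
   Formalization: The positive vertex weights and ε are taken to be rational numbers instead of real numbers; running time counts each addition or comparison of weights as one step. -}

module Defs where

open import Data.Bool.Base using (Bool; true; false; T; if_then_else_)
open import Data.Fin.Base using (Fin; toℕ)
open import Data.Fin.Subset using (Subset; _∈_)
open import Data.List.Base as List using (List; []; _∷_)
open import Data.Nat.Base as ℕ using (ℕ; zero; suc; ∣_-_∣)
open import Data.Product using (∃; ∃!; _×_; _,_)
open import Data.Rational.Base as ℚ using (ℚ; 0ℚ; 1ℚ; Positive; 1/_)
open import Data.Rational.Properties as ℚ using (+-0-commutativeMonoid; pos+pos⇒pos; pos⇒nonZero)
open import Data.Vec.Base as Vec using (Vec; lookup)
open import Function.Bundles using (_⇔_)
open import Function.Definitions using (Injective)
open import Relation.Binary.PropositionalEquality.Core using (_≡_; _≢_)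
open import Relation.Nullary.Negation.Core using (¬_)
open import Algebra.Properties.CommutativeMonoid.Sum +-0-commutativeMonoid using (sum)

record WeightedGraph : Set where
  field
    order      : ℕ
    edge       : Fin order → Fin order → Bool
    edge-sym   : ∀ u v → edge u v ≡ edge v u
    edge-irr   : ∀ v → edge v v ≡ false
    weight     : Fin order → ℚ
    weight-pos : ∀ v → Positive (weight v)

1/[1+_] : (ε : ℚ) → {{Positive ε}} → ℚ
1/[1+ ε ] = 1/_ (1ℚ ℚ.+ ε) {{pos⇒nonZero (1ℚ ℚ.+ ε) {{pos+pos⇒pos 1ℚ ε}}}}

module _ (G : WeightedGraph) where
  open WeightedGraph G

  Independent : Subset order → Set
  Independent S = ∀ u v → u ∈ S → v ∈ S → ¬ T (edge u v)

  totalWeight : Subset order → ℚ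
  totalWeight S = sum (λ v → if lookup S v then weight v else 0ℚ)

  MaximumIndependent : Subset order → Set
  MaximumIndependent S =
    Independent S × (∀ S′ → Independent S′ → totalWeight S′ ℚ.≤ totalWeight S)

  Approximation : (ε : ℚ) → {{Positive ε}} → Subset order → Set
  Approximation ε S =
    Independent S ×
    ∃ λ S* → MaximumIndependent S* × 1/[1+ ε ] ℚ.* totalWeight S* ℚ.≤ totalWeight S

-- An element i of Fin n stands for the coordinate suc (toℕ i) ∈ {1,…,n}.

Grid : (d n : ℕ) → Set
Grid d n = Vec (Fin n) d

ShareLineOfSight : ∀ {d n} → Grid d n → Grid d n → Set
ShareLineOfSight x y = ∃! _≡_ λ i → lookup x i ≢ lookup y i

manhattan : ∀ {d n} → Grid d n → Grid d n → ℕ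
manhattan x y = Vec.sum (Vec.zipWith (λ a b → ∣ toℕ a - toℕ b ∣) x y)

record LoSNetwork (d ω n : ℕ) : Set where
  field
    graph : WeightedGraph
  open WeightedGraph graph public
  field
    embed     : Fin order → Grid d n
    injective : Injective _≡_ _≡_ embed
    edge-iff  : ∀ u v → T (edge u v) ⇔
                  (ShareLineOfSight (embed u) (embed v) ×
                   manhattan (embed u) (embed v) ℕ.< ω)

-- Algorithms are programs of a Turing-complete first-order language with
-- while loops; running time is the number of executed instructions.  Each
-- instruction is a constant number of pointer operations (data are built by
-- pairing and consing, and shared, never copied), an increment, decrement or
-- comparison of natural numbers, or an addition or comparison of weights.
-- In t steps a natural number grows by at most t, and a weight is a sum of
-- at most 2 ^ t input weights, so with bit costs charged instead, the time
-- stays polynomial in t and the bit length of the input.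
-- Weights can only be added and compared: no instruction converts a weight
-- into other data, and 0ℚ is the only weight constant.

infixr 7 _`×_
data Ty : Set where
  `bool `nat `weight : Ty
  _`×_  : Ty → Ty → Ty
  `list : Ty → Ty

⟦_⟧ : Ty → Set
⟦ `bool ⟧   = Bool
⟦ `nat ⟧    = ℕ
⟦ `weight ⟧ = ℚ
⟦ σ `× τ ⟧  = ⟦ σ ⟧ × ⟦ τ ⟧
⟦ `list σ ⟧ = List ⟦ σ ⟧

infix  4 _⇒_
infixr 6 _⨾_
data _⇒_ : Ty → Ty → Set where
  `id     : ∀ {σ} → σ ⇒ σ
  _⨾_     : ∀ {σ τ υ} → σ ⇒ τ → τ ⇒ υ → σ ⇒ υ
  `if     : ∀ {σ τ} → σ ⇒ `bool → σ ⇒ τ → σ ⇒ τ → σ ⇒ τ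
  `while  : ∀ {σ} → σ ⇒ `bool → σ ⇒ σ → σ ⇒ σ
  `pair   : ∀ {σ τ υ} → σ ⇒ τ → σ ⇒ υ → σ ⇒ τ `× υ
  `fst    : ∀ {σ τ} → σ `× τ ⇒ σ
  `snd    : ∀ {σ τ} → σ `× τ ⇒ τ
  `true   : ∀ {σ} → σ ⇒ `bool
  `false  : ∀ {σ} → σ ⇒ `bool
  `zero   : ∀ {σ} → σ ⇒ `nat
  `suc    : `nat ⇒ `nat
  `caseℕ  : ∀ {σ τ} → σ ⇒ τ → `nat `× σ ⇒ τ → `nat `× σ ⇒ τ
  `≤ℕ     : `nat `× `nat ⇒ `bool
  `nil    : ∀ {σ τ} → σ ⇒ `list τ
  `cons   : ∀ {σ} → σ `× `list σ ⇒ `list σ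
  `caseL  : ∀ {α σ τ} → σ ⇒ τ → α `× `list α `× σ ⇒ τ → `list α `× σ ⇒ τ
  `0w     : ∀ {σ} → σ ⇒ `weight
  `+w     : `weight `× `weight ⇒ `weight
  `≤w     : `weight `× `weight ⇒ `bool

-- p ⊢ x ⇓ y ∣ t : program p halts on input x with output y after t steps.

infix 3 _⊢_⇓_∣_
data _⊢_⇓_∣_ : ∀ {σ τ} → σ ⇒ τ → ⟦ σ ⟧ → ⟦ τ ⟧ → ℕ → Set where
  id⇓      : ∀ {σ} {x : ⟦ σ ⟧} → `id {σ} ⊢ x ⇓ x ∣ 1
  seq⇓     : ∀ {σ τ υ} {p : σ ⇒ τ} {q : τ ⇒ υ} {x y z s t} →
             p ⊢ x ⇓ y ∣ s → q ⊢ y ⇓ z ∣ t → p ⨾ q ⊢ x ⇓ z ∣ suc (s ℕ.+ t)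
  ifᵗ⇓     : ∀ {σ τ} {b : σ ⇒ `bool} {p q : σ ⇒ τ} {x y s t} →
             b ⊢ x ⇓ true ∣ s → p ⊢ x ⇓ y ∣ t → `if b p q ⊢ x ⇓ y ∣ suc (s ℕ.+ t)
  ifᶠ⇓     : ∀ {σ τ} {b : σ ⇒ `bool} {p q : σ ⇒ τ} {x y s t} →
             b ⊢ x ⇓ false ∣ s → q ⊢ x ⇓ y ∣ t → `if b p q ⊢ x ⇓ y ∣ suc (s ℕ.+ t)
  whileᶠ⇓  : ∀ {σ} {b : σ ⇒ `bool} {p : σ ⇒ σ} {x s} →
             b ⊢ x ⇓ false ∣ s → `while b p ⊢ x ⇓ x ∣ suc s
  whileᵗ⇓  : ∀ {σ} {b : σ ⇒ `bool} {p : σ ⇒ σ} {x y z r s t} →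
             b ⊢ x ⇓ true ∣ r → p ⊢ x ⇓ y ∣ s → `while b p ⊢ y ⇓ z ∣ t →
             `while b p ⊢ x ⇓ z ∣ suc (r ℕ.+ s ℕ.+ t)
  pair⇓    : ∀ {σ τ υ} {p : σ ⇒ τ} {q : σ ⇒ υ} {x y z s t} →
             p ⊢ x ⇓ y ∣ s → q ⊢ x ⇓ z ∣ t → `pair p q ⊢ x ⇓ (y , z) ∣ suc (s ℕ.+ t)
  fst⇓     : ∀ {σ τ} {x : ⟦ σ ⟧} {y : ⟦ τ ⟧} → `fst {σ} {τ} ⊢ (x , y) ⇓ x ∣ 1
  snd⇓     : ∀ {σ τ} {x : ⟦ σ ⟧} {y : ⟦ τ ⟧} → `snd {σ} {τ} ⊢ (x , y) ⇓ y ∣ 1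
  true⇓    : ∀ {σ} {x : ⟦ σ ⟧} → `true {σ} ⊢ x ⇓ true ∣ 1
  false⇓   : ∀ {σ} {x : ⟦ σ ⟧} → `false {σ} ⊢ x ⇓ false ∣ 1
  zero⇓    : ∀ {σ} {x : ⟦ σ ⟧} → `zero {σ} ⊢ x ⇓ zero ∣ 1
  suc⇓     : ∀ {m} → `suc ⊢ m ⇓ suc m ∣ 1
  caseℕ⁰⇓  : ∀ {σ τ} {p : σ ⇒ τ} {q : `nat `× σ ⇒ τ} {x y t} →
             p ⊢ x ⇓ y ∣ t → `caseℕ p q ⊢ (zero , x) ⇓ y ∣ suc t
  caseℕ⁺⇓  : ∀ {σ τ} {p : σ ⇒ τ} {q : `nat `× σ ⇒ τ} {m x y t} →
             q ⊢ (m , x) ⇓ y ∣ t → `caseℕ p q ⊢ (suc m , x) ⇓ y ∣ suc t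
  ≤ℕ⇓      : ∀ {m n} → `≤ℕ ⊢ (m , n) ⇓ (m ℕ.≤ᵇ n) ∣ 1
  nil⇓     : ∀ {σ τ} {x : ⟦ σ ⟧} → `nil {σ} {τ} ⊢ x ⇓ [] ∣ 1
  cons⇓    : ∀ {σ} {x : ⟦ σ ⟧} {xs : List ⟦ σ ⟧} → `cons {σ} ⊢ (x , xs) ⇓ (x ∷ xs) ∣ 1
  caseL⁰⇓  : ∀ {α σ τ} {p : σ ⇒ τ} {q : α `× `list α `× σ ⇒ τ} {x y t} →
             p ⊢ x ⇓ y ∣ t → `caseL p q ⊢ ([] , x) ⇓ y ∣ suc t
  caseL⁺⇓  : ∀ {α σ τ} {p : σ ⇒ τ} {q : α `× `list α `× σ ⇒ τ} {a as x y t} →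
             q ⊢ (a , as , x) ⇓ y ∣ t → `caseL p q ⊢ (a ∷ as , x) ⇓ y ∣ suc t
  0w⇓      : ∀ {σ} {x : ⟦ σ ⟧} → `0w {σ} ⊢ x ⇓ 0ℚ ∣ 1
  +w⇓      : ∀ {a b} → `+w ⊢ (a , b) ⇓ (a ℚ.+ b) ∣ 1
  ≤w⇓      : ∀ {a b} → `≤w ⊢ (a , b) ⇓ (a ℚ.≤ᵇ b) ∣ 1

-- A network is given by n and, for each vertex, its coordinates in the grid,
-- its weight and its row of the adjacency matrix.

`vertex `network : Ty
`vertex  = `list `nat `× `weight `× `list `bool
`network = `nat `× `list `vertex

encode : ∀ {d ω n} → LoSNetwork d ω n → ⟦ `network ⟧
encode {n = n} N = n , List.tabulate λ v →
    Vec.toList (Vec.map (λ i → suc (toℕ i)) (embed v))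
  , weight v
  , List.tabulate (edge v)
  where open LoSNetwork N

-- A set of vertices is returned as its characteristic vector.

`vertexSet : Ty
`vertexSet = `list `bool

encodeSet : ∀ {m} → Subset m → ⟦ `vertexSet ⟧
encodeSet = Vec.toList

{-# OPTIONS --safe #-}
module Submission where

-- Shifting.  Put q = the denominator of ε, J = (q + 1) d and L = J ω, and for j < J cut every
-- axis into cells of length L displaced by j ω, discarding the points with some coordinate among
-- the first ω positions (the margin) of its cell.  Remaining points of different cells are not
-- adjacent, and a cell contains at most L ^ d vertices, so an optimum of the remaining graph is
-- found cell by cell with a branching algorithm of constant depth.  For every coordinate of a
-- vertex at most one j puts it into a margin, so the J optima have total weight at least
-- (J − d) times the optimum, and the best of them is within the factor J / (J − d) = 1 + 1/q.
--
-- Since d, ω and ε are fixed, the loops over coordinates, displacements and branching depth are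
-- unrolled into the program; only loops over lists and coordinate values are while loops.

open import Defs
open import Algebra.Bundles using (CommutativeMonoid)
open import Data.Bool.Base using (Bool; true; false; T; if_then_else_; _∧_; not)
open import Data.Bool.Properties using (T?)
open import Data.Empty using (⊥-elim)
open import Data.Fin.Base as Fin using (Fin; zero; suc; toℕ)
open import Data.Fin.Properties using (injective⇒≤; finToFun-funToFin; fromℕ<-injective; toℕ-injective; toℕ<n)
open import Data.Fin.Subset using (Subset)
open import Data.Integer.Base as ℤ using ()
import Data.Integer.Properties as ℤ
open import Data.List.Base as List using (List; []; _∷_; foldl; foldr; map; length; reverse; filterᵇ; upTo; allFin; _ʳ++_)
open import Data.List.Membership.Propositional using (_∈_; _∉_)
open import Data.List.Membership.Propositional.Properties using (∈-filter⁻; ∈-upTo⁻; ∈-lookup)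
open import Data.List.Properties using (reverse-foldl; reverse-involutive; length-filter; length-upTo; length-tabulate; map-∘; map-tabulate; tabulate-cong)
open import Data.List.Relation.Unary.All as All using ()
open import Data.List.Relation.Unary.AllPairs using ([]; _∷_)
open import Data.List.Relation.Unary.Any using (here; there)
open import Data.List.Relation.Unary.Unique.Propositional using (Unique)
import Data.List.Relation.Unary.Unique.Propositional.Properties as Unique
open import Data.Nat.Base using (ℕ; zero; suc; _≤_; _<_; z≤n; s≤s; _+_; _*_; _^_; _≤ᵇ_; ∣_-_∣; NonZero)
open import Data.Nat.Properties
open import Data.Nat.Tactic.RingSolver using (solve-∀)
open import Data.Product using (∃; ∃₂; Σ-syntax; _×_; _,_; proj₁; proj₂)
open import Data.Rational.Base as ℚ using (ℚ; mkℚ; 0ℚ; 1ℚ; Positive; NonNegative; toℚᵘ)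
import Data.Rational.Properties as ℚ
import Data.Rational.Unnormalised.Base as ℚᵘ
import Data.Rational.Unnormalised.Properties as ℚᵘ
open import Data.Sum.Base using (inj₁; inj₂)
open import Data.Vec.Base as Vec using (Vec; []; _∷_; lookup; toList)
open import Data.Vec.Properties using ([]=⇒lookup; lookup⇒[]=; lookup∘tabulate; lookup-map)
open import Function.Base using (_∘_)
open import Function.Bundles using (Equivalence)
open import Relation.Binary.Definitions using (tri<; tri≈; tri>)
open import Relation.Binary.PropositionalEquality hiding (J)
open import Relation.Nullary using (¬_; contradiction)
open import Algebra.Properties.CommutativeMonoid.Mult ℚ.+-0-commutativeMonoid using (×-distrib-+)
open import Algebra.Properties.CommutativeMonoid.Sum ℚ.+-0-commutativeMonoid using (sum)
open import Algebra.Properties.CommutativeSemigroup (CommutativeMonoid.commutativeSemigroup ℚ.+-0-commutativeMonoid) using (interchange)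
open import Algebra.Properties.Monoid.Mult ℚ.+-0-monoid using (×-homo-+; ×-assocˡ) renaming (_×_ to _·_)

-- Polynomial time

-- A loop with a polynomial body may still let its state grow exponentially, so folds demand a bound
-- on the growth of their accumulator. The search is written once, generic in the vertex type: its
-- correctness is proved on `Fin order`, the program runs it on encoded vertices, and naturality
-- connects the two.
--
-- Cells and discarding are captured by one relation, symmetric and transitive but not reflexive: a
-- point is discarded exactly when it is not related to itself. Cells are never enumerated; each
-- vertex reruns the search on its own class.
--
-- Because the displacements are multiples of ω and L = J ω, the J margins of an axis occupy
-- disjoint residue intervals modulo L, which is why a coordinate is hit by at most one j. The
-- choice of J makes J - d = q d, and q ε ≥ 1 because ε has numerator at least 1.

infixl 6 _⊕_
infixl 7 _⊗_
infixr 8 _⊙_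
-- Expressions without subtraction are monotone, so a bound can be evaluated at any upper bound of
-- the size, and composition stays inside the syntax.
data Poly : Set where
  con : ℕ → Poly
  var : Poly
  _⊕_ _⊗_ _⊙_ : Poly → Poly → Poly

eval : Poly → ℕ → ℕ
eval (con c) n = c
eval var     n = n
eval (P ⊕ Q) n = eval P n + eval Q n
eval (P ⊗ Q) n = eval P n * eval Q n
eval (P ⊙ Q) n = eval P (eval Q n)

eval-mono : ∀ P {m n} → m ≤ n → eval P m ≤ eval P n
eval-mono (con c) m≤n = ≤-refl
eval-mono var     m≤n = m≤n
eval-mono (P ⊕ Q) m≤n = +-mono-≤ (eval-mono P m≤n) (eval-mono Q m≤n)
eval-mono (P ⊗ Q) m≤n = *-mono-≤ (eval-mono P m≤n) (eval-mono Q m≤n)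
eval-mono (P ⊙ Q) m≤n = eval-mono P (eval-mono Q m≤n)

^-distribʳ-* : ∀ k m n → (m * n) ^ k ≡ m ^ k * n ^ k
^-distribʳ-* zero    m n = refl
^-distribʳ-* (suc k) m n =
  trans (cong (m * n *_) (^-distribʳ-* k m n)) ([m*n]*[o*p]≡[m*o]*[n*p] m n (m ^ k) (n ^ k))

-- The base `suc n` is at least 1, so its powers increase with the exponent and the terms of a sum
-- can be raised to a common exponent; with base `n` this fails at 0.
eval-≤-suc^ : ∀ P → ∃₂ λ c k → ∀ n → eval P n ≤ c * suc n ^ k
eval-≤-suc^ (con c) = c , 0 , λ n → ≤-reflexive (sym (*-identityʳ c))
eval-≤-suc^ var = 1 , 1 , λ n → ≤-trans (n≤1+n n) (≤-reflexive (lemma n))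
  where
  lemma : ∀ n → suc n ≡ 1 * suc n ^ 1
  lemma n = sym (trans (*-identityˡ (suc n ^ 1)) (^-identityʳ (suc n)))
eval-≤-suc^ (P ⊕ Q) with c₁ , k₁ , P≤ ← eval-≤-suc^ P | c₂ , k₂ , Q≤ ← eval-≤-suc^ Q =
  c₁ + c₂ , k₁ + k₂ , λ n → ≤-trans
    (+-mono-≤ (≤-trans (P≤ n) (*-monoʳ-≤ c₁ (^-monoʳ-≤ (suc n) (m≤m+n k₁ k₂))))
              (≤-trans (Q≤ n) (*-monoʳ-≤ c₂ (^-monoʳ-≤ (suc n) (m≤n+m k₂ k₁)))))
    (≤-reflexive (sym (*-distribʳ-+ (suc n ^ (k₁ + k₂)) c₁ c₂)))
eval-≤-suc^ (P ⊗ Q) with c₁ , k₁ , P≤ ← eval-≤-suc^ P | c₂ , k₂ , Q≤ ← eval-≤-suc^ Q =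
  c₁ * c₂ , k₁ + k₂ , λ n → ≤-trans (*-mono-≤ (P≤ n) (Q≤ n))
    (≤-reflexive (trans ([m*n]*[o*p]≡[m*o]*[n*p] c₁ _ c₂ _)
                        (cong (c₁ * c₂ *_) (sym (^-distribˡ-+-* (suc n) k₁ k₂)))))
eval-≤-suc^ (P ⊙ Q) with c₁ , k₁ , P≤ ← eval-≤-suc^ P | c₂ , k₂ , Q≤ ← eval-≤-suc^ Q =
  c₁ * suc c₂ ^ k₁ , k₂ * k₁ , λ n → let N = suc n in begin
    eval P (eval Q n)                        ≤⟨ P≤ (eval Q n) ⟩
    c₁ * suc (eval Q n) ^ k₁                 ≤⟨ *-monoʳ-≤ c₁ (^-monoˡ-≤ k₁ (+-mono-≤ (m^n>0 N k₂) (Q≤ n))) ⟩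
    c₁ * (suc c₂ * N ^ k₂) ^ k₁              ≡⟨ cong (c₁ *_) (^-distribʳ-* k₁ (suc c₂) (N ^ k₂)) ⟩
    c₁ * (suc c₂ ^ k₁ * (N ^ k₂) ^ k₁)       ≡⟨ *-assoc c₁ _ _ ⟨
    c₁ * suc c₂ ^ k₁ * (N ^ k₂) ^ k₁         ≡⟨ cong (c₁ * suc c₂ ^ k₁ *_) (^-*-assoc N k₂ k₁) ⟩
    c₁ * suc c₂ ^ k₁ * N ^ (k₂ * k₁)         ∎
  where open ≤-Reasoning

-- For positive n, n + 1 ≤ 2n, whence the factor `2 ^ k`; the additive constant covers n = 0.
eval-≤-^ : ∀ P → ∃₂ λ c k → ∀ n → eval P n ≤ c * n ^ k + c
eval-≤-^ P with c , k , P≤ ← eval-≤-suc^ P = c * 2 ^ k , k , bound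
  where
  open ≤-Reasoning
  bound : ∀ n → eval P n ≤ c * 2 ^ k * n ^ k + c * 2 ^ k
  bound zero = begin
    eval P 0        ≤⟨ P≤ 0 ⟩
    c * 1 ^ k       ≤⟨ *-monoʳ-≤ c (^-monoˡ-≤ k (s≤s z≤n)) ⟩
    c * 2 ^ k       ≤⟨ m≤n+m _ _ ⟩
    c * 2 ^ k * 0 ^ k + c * 2 ^ k ∎
  bound n@(suc m) = begin
    eval P n                    ≤⟨ P≤ n ⟩
    c * suc n ^ k               ≤⟨ *-monoʳ-≤ c (^-monoˡ-≤ k (s≤s (m≤n+m n m))) ⟩
    c * (n + n) ^ k             ≡⟨ cong (λ z → c * (n + z) ^ k) (+-identityʳ n) ⟨
    c * (2 * n) ^ k             ≡⟨ cong (c *_) (^-distribʳ-* k 2 n) ⟩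
    c * (2 ^ k * n ^ k)         ≡⟨ *-assoc c _ _ ⟨
    c * 2 ^ k * n ^ k           ≤⟨ m≤m+n _ _ ⟩
    c * 2 ^ k * n ^ k + c * 2 ^ k ∎

-- Naturals count with their value, so that counting loops are polynomial; coordinates are at most
-- n, hence this is harmless. A weight counts 1 because arithmetic on weights takes one step. Every
-- list cell counts 1, so sizes bound lengths.
size : (σ : Ty) → ⟦ σ ⟧ → ℕ
size `bool     b        = 1
size `nat      n        = n
size `weight   w        = 1
size (σ `× τ)  (x , y)  = size σ x + size τ y
size (`list σ) []       = 0
size (`list σ) (x ∷ xs) = suc (size σ x + size (`list σ) xs)

length≤size : ∀ σ xs → length xs ≤ size (`list σ) xs
length≤size σ []       = z≤n
length≤size σ (x ∷ xs) = s≤s (≤-trans (length≤size σ xs) (m≤n+m _ _))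

-- Bounding the output size as well makes the class closed under composition.

record PolyTime (σ τ : Ty) (f : ⟦ σ ⟧ → ⟦ τ ⟧) : Set where
  field
    prog       : σ ⇒ τ
    time space : Poly
    runs       : ∀ x → ∃ λ t → (prog ⊢ x ⇓ f x ∣ t) × t ≤ eval time (size σ x)
    grows      : ∀ x → size τ (f x) ≤ eval space (size σ x)
open PolyTime

private variable
  σ τ υ α β γ : Ty

runs-within : ∀ {f : ⟦ σ ⟧ → ⟦ τ ⟧} (p : PolyTime σ τ f) (P : Poly) →
  ∃₂ λ c k → ∀ n x → size σ x ≤ eval P n → ∃ λ t → (prog p ⊢ x ⇓ f x ∣ t) × t ≤ c * n ^ k + c
runs-within p P =
  let c , k , bound = eval-≤-^ (time p ⊙ P) in
  c , k , λ n x x≤ →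
    let t , r , t≤ = runs p x in t , r , ≤-trans t≤ (≤-trans (eval-mono (time p) x≤) (bound n))

≗-polyTime : ∀ {f g : ⟦ σ ⟧ → ⟦ τ ⟧} → (∀ x → f x ≡ g x) → PolyTime σ τ f → PolyTime σ τ g
≗-polyTime {τ = τ} f≗g p = record
  { prog  = prog p
  ; time  = time p
  ; space = space p
  ; runs  = λ x → let t , r , t≤ = runs p x in t , subst (λ y → prog p ⊢ x ⇓ y ∣ t) (f≗g x) r , t≤
  ; grows = λ x → subst (λ y → size τ y ≤ _) (f≗g x) (grows p x)
  }

constant-time : ∀ {f : ⟦ σ ⟧ → ⟦ τ ⟧} (p : σ ⇒ τ) (c : ℕ) →
                (∀ x → p ⊢ x ⇓ f x ∣ 1) → (∀ x → size τ (f x) ≤ c + size σ x) → PolyTime σ τ f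
constant-time p c r g = record
  { prog = p ; time = con 1 ; space = con c ⊕ var ; runs = λ x → 1 , r x , ≤-refl ; grows = g }

idₚ : PolyTime σ σ (λ x → x)
idₚ = constant-time `id 0 (λ _ → id⇓) (λ _ → ≤-refl)

fstₚ : PolyTime (σ `× τ) σ proj₁
fstₚ = constant-time `fst 0 (λ _ → fst⇓) (λ _ → m≤m+n _ _)

sndₚ : PolyTime (σ `× τ) τ proj₂
sndₚ = constant-time `snd 0 (λ _ → snd⇓) (λ (x , _) → m≤n+m _ _)

trueₚ : PolyTime σ `bool (λ _ → true)
trueₚ = constant-time `true 1 (λ _ → true⇓) (λ _ → s≤s z≤n)

falseₚ : PolyTime σ `bool (λ _ → false)
falseₚ = constant-time `false 1 (λ _ → false⇓) (λ _ → s≤s z≤n)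

nilₚ : PolyTime σ (`list τ) (λ _ → [])
nilₚ = constant-time `nil 0 (λ _ → nil⇓) (λ _ → z≤n)

0wₚ : PolyTime σ `weight (λ _ → 0ℚ)
0wₚ = constant-time `0w 1 (λ _ → 0w⇓) (λ _ → s≤s z≤n)

infixr 6 _⨾ₚ_
_⨾ₚ_ : ∀ {f : ⟦ σ ⟧ → ⟦ τ ⟧} {g : ⟦ τ ⟧ → ⟦ υ ⟧} →
       PolyTime σ τ f → PolyTime τ υ g → PolyTime σ υ (λ x → g (f x))
_⨾ₚ_ {f = f} p q = record
  { prog  = prog p ⨾ prog q
  ; time  = con 1 ⊕ (time p ⊕ time q ⊙ space p)
  ; space = space q ⊙ space p
  ; runs  = λ x → let s , r , s≤ = runs p x ; t , r′ , t≤ = runs q (f x) in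
      _ , seq⇓ r r′ , s≤s (+-mono-≤ s≤ (≤-trans t≤ (eval-mono (time q) (grows p x))))
  ; grows = λ x → ≤-trans (grows q (f x)) (eval-mono (space q) (grows p x))
  }

pairₚ : ∀ {f : ⟦ σ ⟧ → ⟦ τ ⟧} {g : ⟦ σ ⟧ → ⟦ υ ⟧} →
        PolyTime σ τ f → PolyTime σ υ g → PolyTime σ (τ `× υ) (λ x → f x , g x)
pairₚ p q = record
  { prog  = `pair (prog p) (prog q)
  ; time  = con 1 ⊕ (time p ⊕ time q)
  ; space = space p ⊕ space q
  ; runs  = λ x → let s , r , s≤ = runs p x ; t , r′ , t≤ = runs q x in
      _ , pair⇓ r r′ , s≤s (+-mono-≤ s≤ t≤)
  ; grows = λ x → +-mono-≤ (grows p x) (grows q x)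
  }

ifₚ : ∀ {b : ⟦ σ ⟧ → Bool} {f g : ⟦ σ ⟧ → ⟦ τ ⟧} →
      PolyTime σ `bool b → PolyTime σ τ f → PolyTime σ τ g →
      PolyTime σ τ (λ x → if b x then f x else g x)
ifₚ {σ} {τ} {b} {f} {g} c p q = record
  { prog  = `if (prog c) (prog p) (prog q)
  ; time  = con 1 ⊕ (time c ⊕ (time p ⊕ time q))
  ; space = space p ⊕ space q
  ; runs  = λ x → let s , r , s≤ = runs c x in run x s≤ (b x) r
  ; grows = λ x → grow x (b x)
  }
  where
  run : ∀ x {s} → s ≤ eval (time c) (size σ x) → ∀ b → prog c ⊢ x ⇓ b ∣ s →
        ∃ λ t → (`if (prog c) (prog p) (prog q) ⊢ x ⇓ (if b then f x else g x) ∣ t) ×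
                t ≤ eval (con 1 ⊕ (time c ⊕ (time p ⊕ time q))) (size σ x)
  run x s≤ true  r = let t , r′ , t≤ = runs p x in
    _ , ifᵗ⇓ r r′ , s≤s (+-mono-≤ s≤ (≤-trans t≤ (m≤m+n _ _)))
  run x s≤ false r = let t , r′ , t≤ = runs q x in
    _ , ifᶠ⇓ r r′ , s≤s (+-mono-≤ s≤ (≤-trans t≤ (m≤n+m _ _)))
  grow : ∀ x b → size τ (if b then f x else g x) ≤ eval (space p ⊕ space q) (size σ x)
  grow x true  = ≤-trans (grows p x) (m≤m+n _ _)
  grow x false = ≤-trans (grows q x) (m≤n+m _ _)

andₚ : ∀ {b c : ⟦ σ ⟧ → Bool} → PolyTime σ `bool b → PolyTime σ `bool c →
       PolyTime σ `bool (λ x → b x ∧ c x)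
andₚ {b = b} {c} p q = ≗-polyTime (λ x → lemma (b x) (c x)) (ifₚ p q falseₚ)
  where
  lemma : ∀ b c → (if b then c else false) ≡ b ∧ c
  lemma true  c = refl
  lemma false c = refl

notₚ : ∀ {b : ⟦ σ ⟧ → Bool} → PolyTime σ `bool b → PolyTime σ `bool (λ x → not (b x))
notₚ {b = b} p = ≗-polyTime (λ x → lemma (b x)) (ifₚ p falseₚ trueₚ)
  where
  lemma : ∀ b → (if b then false else true) ≡ not b
  lemma true  = refl
  lemma false = refl

sucₚ : ∀ {f : ⟦ σ ⟧ → ℕ} → PolyTime σ `nat f → PolyTime σ `nat (λ x → suc (f x))
sucₚ p = p ⨾ₚ constant-time `suc 1 (λ _ → suc⇓) (λ _ → ≤-refl)

natₚ : ∀ n → PolyTime σ `nat (λ _ → n)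
natₚ zero    = constant-time `zero 0 (λ _ → zero⇓) (λ _ → z≤n)
natₚ (suc n) = sucₚ (natₚ n)

leqₚ : ∀ {f g : ⟦ σ ⟧ → ℕ} → PolyTime σ `nat f → PolyTime σ `nat g →
       PolyTime σ `bool (λ x → f x ≤ᵇ g x)
leqₚ p q = pairₚ p q ⨾ₚ constant-time `≤ℕ 1 (λ _ → ≤ℕ⇓) (λ _ → s≤s z≤n)

consₚ : ∀ {f : ⟦ σ ⟧ → ⟦ τ ⟧} {g : ⟦ σ ⟧ → List ⟦ τ ⟧} →
        PolyTime σ τ f → PolyTime σ (`list τ) g → PolyTime σ (`list τ) (λ x → f x ∷ g x)
consₚ p q = pairₚ p q ⨾ₚ constant-time `cons 1 (λ _ → cons⇓) (λ _ → ≤-refl)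

addₚ : ∀ {f g : ⟦ σ ⟧ → ℚ} → PolyTime σ `weight f → PolyTime σ `weight g →
       PolyTime σ `weight (λ x → f x ℚ.+ g x)
addₚ p q = pairₚ p q ⨾ₚ constant-time `+w 0 (λ _ → +w⇓) (λ _ → s≤s z≤n)

leqwₚ : ∀ {f g : ⟦ σ ⟧ → ℚ} → PolyTime σ `weight f → PolyTime σ `weight g →
        PolyTime σ `bool (λ x → f x ℚ.≤ᵇ g x)
leqwₚ p q = pairₚ p q ⨾ₚ constant-time `≤w 0 (λ _ → ≤w⇓) (λ _ → s≤s z≤n)

caseList : ∀ {A B : Set} → B → (A → List A → B) → List A → B
caseList z s []       = z
caseList z s (x ∷ xs) = s x xs

caseListₚ : ∀ {f : ⟦ σ ⟧ → ⟦ τ ⟧} {g : ⟦ α `× `list α `× σ ⟧ → ⟦ τ ⟧} {l : ⟦ σ ⟧ → List ⟦ α ⟧} →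
            PolyTime σ (`list α) l → PolyTime σ τ f → PolyTime (α `× `list α `× σ) τ g →
            PolyTime σ τ (λ x → caseList (f x) (λ a as → g (a , as , x)) (l x))
caseListₚ {σ} {τ} {α} {f} {g} {l} scrutinee p q = pairₚ scrutinee idₚ ⨾ₚ branch
  where
  run : ∀ as x → ∃ λ t →
        (`caseL (prog p) (prog q) ⊢ (as , x) ⇓ caseList (f x) (λ a as → g (a , as , x)) as ∣ t) ×
        t ≤ eval (con 1 ⊕ (time p ⊕ time q)) (size (`list α) as + size σ x)
  run [] x = let t , r , t≤ = runs p x in
    _ , caseL⁰⇓ r , s≤s (≤-trans t≤ (m≤m+n _ _))
  run (a ∷ as) x = let t , r , t≤ = runs q (a , as , x) in
    _ , caseL⁺⇓ r , s≤s (≤-trans t≤ (≤-trans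
      (eval-mono (time q) (≤-trans (≤-reflexive (sym (+-assoc (size α a) _ _))) (n≤1+n _))) (m≤n+m _ _)))
  grow : ∀ as x → size τ (caseList (f x) (λ a as → g (a , as , x)) as) ≤
         eval (space p ⊕ space q) (size (`list α) as + size σ x)
  grow []       x = ≤-trans (grows p x) (m≤m+n _ _)
  grow (a ∷ as) x = ≤-trans (grows q _) (≤-trans
      (eval-mono (space q) (≤-trans (≤-reflexive (sym (+-assoc (size α a) _ _))) (n≤1+n _))) (m≤n+m _ _))
  branch : PolyTime (`list α `× σ) τ (λ (as , x) → caseList (f x) (λ a as → g (a , as , x)) as)
  branch = record
    { prog  = `caseL (prog p) (prog q)
    ; time  = con 1 ⊕ (time p ⊕ time q)
    ; space = space p ⊕ space q
    ; runs  = λ (as , x) → run as x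
    ; grows = λ (as , x) → grow as x
    }

caseNat : ∀ {B : Set} → B → (ℕ → B) → ℕ → B
caseNat z s zero    = z
caseNat z s (suc n) = s n

caseNatₚ : ∀ {f : ⟦ σ ⟧ → ⟦ τ ⟧} {g : ⟦ `nat `× σ ⟧ → ⟦ τ ⟧} {n : ⟦ σ ⟧ → ℕ} →
           PolyTime σ `nat n → PolyTime σ τ f → PolyTime (`nat `× σ) τ g →
           PolyTime σ τ (λ x → caseNat (f x) (λ m → g (m , x)) (n x))
caseNatₚ {σ} {τ} {f} {g} {n} scrutinee p q = pairₚ scrutinee idₚ ⨾ₚ branch
  where
  run : ∀ m x → ∃ λ t →
        (`caseℕ (prog p) (prog q) ⊢ (m , x) ⇓ caseNat (f x) (λ m → g (m , x)) m ∣ t) ×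
        t ≤ eval (con 1 ⊕ (time p ⊕ time q)) (m + size σ x)
  run zero x = let t , r , t≤ = runs p x in
    _ , caseℕ⁰⇓ r , s≤s (≤-trans t≤ (m≤m+n _ _))
  run (suc m) x = let t , r , t≤ = runs q (m , x) in
    _ , caseℕ⁺⇓ r , s≤s (≤-trans t≤ (≤-trans (eval-mono (time q) (n≤1+n _)) (m≤n+m _ _)))
  grow : ∀ m x → size τ (caseNat (f x) (λ m → g (m , x)) m) ≤
         eval (space p ⊕ space q) (m + size σ x)
  grow zero    x = ≤-trans (grows p x) (m≤m+n _ _)
  grow (suc m) x = ≤-trans (grows q _) (≤-trans (eval-mono (space q) (n≤1+n _)) (m≤n+m _ _))
  branch : PolyTime (`nat `× σ) τ (λ (m , x) → caseNat (f x) (λ m → g (m , x)) m)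
  branch = record
    { prog  = `caseℕ (prog p) (prog q)
    ; time  = con 1 ⊕ (time p ⊕ time q)
    ; space = space p ⊕ space q
    ; runs  = λ (m , x) → run m x
    ; grows = λ (m , x) → grow m x
    }

-- Folds as while loops

module _ {g : ⟦ β `× α `× σ ⟧ → ⟦ α ⟧} (p : PolyTime (β `× α `× σ) α g) where

  private
    step : ⟦ σ ⟧ → ⟦ α ⟧ → ⟦ β ⟧ → ⟦ α ⟧
    step s a b = g (b , a , s)

    loop : `list β `× α `× σ ⇒ `list β `× α `× σ
    loop = `while (`caseL `false `true)
                  (`caseL (`pair `nil `id)
                          (`pair (`snd ⨾ `fst)
                                 (`pair (`pair `fst (`snd ⨾ `snd) ⨾ prog p) (`snd ⨾ `snd ⨾ `snd))))

    -- The invariant on the accumulator ranges over all lists no larger than the remaining one; it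
    -- passes to the next round by prepending the consumed element. `M` bounds the argument of the
    -- body in every round, so all rounds share one time bound.
    loop-runs : ∀ s B M xs a →
      (∀ zs → size (`list β) zs ≤ size (`list β) xs → size α (foldl (step s) a zs) ≤ B) →
      size (`list β) xs + (B + size σ s) ≤ M →
      ∃ λ t → (loop ⊢ (xs , a , s) ⇓ ([] , foldl (step s) a xs , s) ∣ t) ×
              t ≤ 3 + length xs * (20 + eval (time p) M)
    loop-runs s B M []       a inv ≤M = _ , whileᶠ⇓ (caseL⁰⇓ false⇓) , ≤-refl
    loop-runs s B M (x ∷ xs) a inv ≤M =
      let t  , r  , t≤  = runs p (x , a , s)
          t′ , r′ , t≤′ = loop-runs s B M xs (step s a x)
                            (λ zs zs≤ → inv (x ∷ zs) (s≤s (+-monoʳ-≤ (size β x) zs≤)))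
                            (≤-trans (+-monoˡ-≤ _ (≤-trans (m≤n+m _ (size β x)) (n≤1+n _))) ≤M)
      in _ , whileᵗ⇓ (caseL⁺⇓ true⇓)
               (caseL⁺⇓ (pair⇓ (seq⇓ snd⇓ fst⇓)
                  (pair⇓ (seq⇓ (pair⇓ fst⇓ (seq⇓ snd⇓ snd⇓)) r) (seq⇓ snd⇓ (seq⇓ snd⇓ snd⇓)))))
               r′
         , (begin
              _                  ≡⟨ count t t′ ⟩
              20 + t + t′        ≤⟨ +-mono-≤ (+-monoʳ-≤ 20 (≤-trans t≤ (eval-mono (time p) arg≤))) t≤′ ⟩
              20 + eval (time p) M + (3 + length xs * (20 + eval (time p) M))
                                 ≡⟨ swap (20 + eval (time p) M) _ ⟩
              3 + (20 + eval (time p) M + length xs * (20 + eval (time p) M)) ∎)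
      where
      open ≤-Reasoning
      -- The left side is the cost read off the evaluation rules: a round spends 20 steps besides
      -- those of the body.
      count : ∀ t t′ → suc (2 + suc (suc (3 + suc (suc (5 + t) + 5))) + t′) ≡ 20 + t + t′
      count = solve-∀
      swap : ∀ a b → a + (3 + b) ≡ 3 + (a + b)
      swap = solve-∀
      arg≤ : size β x + (size α a + size σ s) ≤ M
      arg≤ = ≤-trans (+-mono-≤ (≤-trans (m≤m+n (size β x) _) (n≤1+n _)) (+-monoˡ-≤ (size σ s) (inv [] z≤n))) ≤M

  -- A body that doubles its accumulator is polynomial while its fold is not, so the bound `G` on
  -- the whole fold has to be supplied from outside.
  foldlₚ : (G : Poly) →
           (∀ xs a s → size α (foldl (step s) a xs) ≤ eval G (size (`list β) xs + (size α a + size σ s))) →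
           PolyTime (`list β `× α `× σ) α (λ (xs , a , s) → foldl (λ a b → g (b , a , s)) a xs)
  foldlₚ G bound = record
    { prog  = loop ⨾ `snd ⨾ `fst
    -- The 7 is the 3 steps of the last, failing test and the 4 of extracting the accumulator.
    ; time  = con 7 ⊕ var ⊗ (con 20 ⊕ time p ⊙ (var ⊕ (G ⊕ var)))
    ; space = G
    ; runs  = λ (xs , a , s) →
        let n = size (`list β) xs + (size α a + size σ s)
            s≤n = ≤-trans (m≤n+m (size σ s) (size α a)) (m≤n+m _ (size (`list β) xs))
            xs≤n = m≤m+n (size (`list β) xs) (size α a + size σ s)
            t , r , t≤ = loop-runs s (eval G n) (n + (eval G n + n)) xs a
              (λ zs zs≤ → ≤-trans (bound zs a s) (eval-mono G (+-monoˡ-≤ _ zs≤)))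
              (+-mono-≤ xs≤n (+-monoʳ-≤ (eval G n) s≤n))
        in _ , seq⇓ r (seq⇓ snd⇓ fst⇓)
             , ≤-trans (≤-reflexive (cong suc (+-comm t 3)))
                 (+-monoʳ-≤ 4 (≤-trans t≤
                   (+-monoʳ-≤ 3 (*-monoˡ-≤ _ (≤-trans (length≤size β xs) xs≤n)))))
    ; grows = λ (xs , a , s) → bound xs a s
    }

  -- The increment may depend on the element and the environment but not on the accumulator, so at
  -- most n rounds add at most n times `G` in total.
  additive-growth : (G : Poly) →
    (∀ b a s → size α (g (b , a , s)) ≤ size α a + eval G (size β b + size σ s)) →
    ∀ xs a s → size α (foldl (step s) a xs) ≤
               eval (var ⊕ var ⊗ G) (size (`list β) xs + (size α a + size σ s))
  additive-growth G add xs a s = ≤-trans (go xs a n≤) (+-mono-≤ a≤ (*-monoˡ-≤ _ len≤))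
    where
    n = size (`list β) xs + (size α a + size σ s)
    n≤ : size (`list β) xs + size σ s ≤ n
    n≤ = +-monoʳ-≤ (size (`list β) xs) (m≤n+m _ _)
    a≤ : size α a ≤ n
    a≤ = ≤-trans (m≤m+n _ _) (m≤n+m _ (size (`list β) xs))
    len≤ : length xs ≤ n
    len≤ = ≤-trans (length≤size β xs) (m≤m+n _ _)
    go : ∀ ys a → size (`list β) ys + size σ s ≤ n →
         size α (foldl (step s) a ys) ≤ size α a + length ys * eval G n
    go []       a ys≤ = m≤m+n _ _
    go (y ∷ ys) a ys≤ = begin
      size α (foldl (step s) (step s a y) ys)        ≤⟨ go ys _ tail≤ ⟩
      size α (step s a y) + length ys * eval G n     ≤⟨ +-monoˡ-≤ _ (≤-trans (add y a s)
                                                          (+-monoʳ-≤ (size α a) (eval-mono G head≤))) ⟩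
      size α a + eval G n + length ys * eval G n     ≡⟨ +-assoc (size α a) _ _ ⟩
      size α a + (eval G n + length ys * eval G n)   ∎
      where
      open ≤-Reasoning
      tail≤ : size (`list β) ys + size σ s ≤ n
      tail≤ = ≤-trans (+-monoˡ-≤ _ (≤-trans (m≤n+m _ (size β y)) (n≤1+n _))) ys≤
      head≤ : size β y + size σ s ≤ n
      head≤ = ≤-trans (+-monoˡ-≤ (size σ s) (≤-trans (m≤m+n (size β y) _) (n≤1+n _))) ys≤

reverseₚ : PolyTime (`list α) (`list α) reverse
-- `Ty` has no unit type; an empty list serves as the environment.
reverseₚ {α} = pairₚ idₚ (pairₚ nilₚ nilₚ) ⨾ₚ
  foldlₚ {σ = `list `bool} push (var ⊕ var ⊗ (con 1 ⊕ var)) (additive-growth push (con 1 ⊕ var) grow)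
  where
  push : PolyTime (α `× `list α `× `list `bool) (`list α) (λ (b , a , _) → b ∷ a)
  push = consₚ fstₚ (sndₚ ⨾ₚ fstₚ)
  grow : ∀ b a s → suc (size α b + size (`list α) a) ≤
                   size (`list α) a + suc (size α b + size (`list `bool) s)
  grow b a s = ≤-trans (s≤s (≤-reflexive (+-comm (size α b) _)))
    (≤-trans (≤-reflexive (sym (+-suc (size (`list α) a) _))) (+-monoʳ-≤ (size (`list α) a) (s≤s (m≤m+n _ _))))

-- The loop consumes a list from the front, so a right fold is a left fold over the reversed list.
-- `mapₚ` and `filterₚ` rest on it to preserve the order of the vertices.
foldrₚ : ∀ {g : ⟦ β `× α `× σ ⟧ → ⟦ α ⟧} (G : Poly) → PolyTime (β `× α `× σ) α g →
         (∀ b a s → size α (g (b , a , s)) ≤ size α a + eval G (size β b + size σ s)) →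
         PolyTime (`list β `× α `× σ) α (λ (xs , a , s) → foldr (λ b a → g (b , a , s)) a xs)
foldrₚ {g = g} G p add =
  ≗-polyTime (λ (xs , a , s) → reverse-foldl (λ a b → g (b , a , s)) a xs)
    (pairₚ (fstₚ ⨾ₚ reverseₚ) sndₚ ⨾ₚ foldlₚ p (var ⊕ var ⊗ G) (additive-growth p G add))

mapₚ : ∀ {h : ⟦ β `× σ ⟧ → ⟦ γ ⟧} {l : ⟦ σ ⟧ → List ⟦ β ⟧} →
       PolyTime (β `× σ) γ h → PolyTime σ (`list β) l →
       PolyTime σ (`list γ) (λ s → map (λ b → h (b , s)) (l s))
mapₚ {β} {σ} {γ} {h} {l} p q = ≗-polyTime (λ s → lemma s (l s))
  (pairₚ q (pairₚ nilₚ idₚ) ⨾ₚ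
   foldrₚ {α = `list γ} (con 1 ⊕ space p) (consₚ (pairₚ fstₚ (sndₚ ⨾ₚ sndₚ) ⨾ₚ p) (sndₚ ⨾ₚ fstₚ))
     (λ b a s → ≤-trans (s≤s (≤-trans (≤-reflexive (+-comm (size γ (h (b , s))) _))
                                      (+-monoʳ-≤ (size (`list γ) a) (grows p (b , s)))))
                        (≤-reflexive (sym (+-suc (size (`list γ) a) _)))))
  where
  lemma : ∀ s xs → foldr (λ b a → h (b , s) ∷ a) [] xs ≡ map (λ b → h (b , s)) xs
  lemma s []       = refl
  lemma s (x ∷ xs) = cong (h (x , s) ∷_) (lemma s xs)

filterₚ : ∀ {h : ⟦ β `× σ ⟧ → Bool} {l : ⟦ σ ⟧ → List ⟦ β ⟧} →
          PolyTime (β `× σ) `bool h → PolyTime σ (`list β) l →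
          PolyTime σ (`list β) (λ s → filterᵇ (λ b → h (b , s)) (l s))
filterₚ {β} {σ} {h} {l} p q = ≗-polyTime (λ s → lemma s (l s))
  (pairₚ q (pairₚ nilₚ idₚ) ⨾ₚ
   foldrₚ {α = `list β} (con 1 ⊕ var)
     (ifₚ (pairₚ fstₚ (sndₚ ⨾ₚ sndₚ) ⨾ₚ p) (consₚ fstₚ (sndₚ ⨾ₚ fstₚ)) (sndₚ ⨾ₚ fstₚ))
     (λ b a s → grow b a s (h (b , s))))
  where
  lemma : ∀ s xs → foldr (λ b a → if h (b , s) then b ∷ a else a) [] xs ≡ filterᵇ (λ b → h (b , s)) xs
  lemma s []       = refl
  lemma s (x ∷ xs) with h (x , s)
  ... | true  = cong (x ∷_) (lemma s xs)
  ... | false = lemma s xs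
  grow : ∀ b a s c → size (`list β) (if c then b ∷ a else a) ≤ size (`list β) a + suc (size β b + size σ s)
  grow b a s false = m≤m+n _ _
  grow b a s true  = ≤-trans (s≤s (≤-reflexive (+-comm (size β b) _)))
    (≤-trans (≤-reflexive (sym (+-suc (size (`list β) a) _))) (+-monoʳ-≤ (size (`list β) a) (s≤s (m≤m+n _ _))))

-- Turns a number into a list of that length, so that loops over coordinate values are folds as
-- well.
unary : ℕ → List Bool → List Bool
unary zero    bs = bs
unary (suc n) bs = unary n (true ∷ bs)

length-unary : ∀ n bs → length (unary n bs) ≡ n + length bs
length-unary zero    bs = refl
length-unary (suc n) bs = trans (length-unary n (true ∷ bs)) (+-suc n (length bs))

unaryₚ : PolyTime `nat (`list `bool) (λ n → unary n [])
unaryₚ = record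
  { prog  = `pair `id `nil ⨾ loop ⨾ `snd
  ; time  = con 9 ⊕ var ⊗ con 13
  ; space = con 2 ⊗ var
  ; runs  = λ n → let t , r , t≤ = loop-runs n [] in
      _ , seq⇓ (pair⇓ id⇓ nil⇓) (seq⇓ r snd⇓) ,
      ≤-trans (≤-reflexive (count t)) (+-monoʳ-≤ 6 t≤)
  ; grows = λ n → ≤-reflexive (trans (size-unary n []) (+-identityʳ (2 * n)))
  }
  where
  loop : `nat `× `list `bool ⇒ `nat `× `list `bool
  loop = `while (`caseℕ `false `true) (`caseℕ (`pair `zero `id) (`pair `fst (`pair `true `snd ⨾ `cons)))
  count : ∀ t → suc (3 + suc (t + 1)) ≡ 6 + t
  count = solve-∀
  loop-runs : ∀ n bs → ∃ λ t → (loop ⊢ (n , bs) ⇓ (0 , unary n bs) ∣ t) × t ≤ 3 + n * 13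
  loop-runs zero    bs = _ , whileᶠ⇓ (caseℕ⁰⇓ false⇓) , ≤-refl
  loop-runs (suc n) bs = let t , r , t≤ = loop-runs n (true ∷ bs) in
    _ , whileᵗ⇓ (caseℕ⁺⇓ true⇓) (caseℕ⁺⇓ (pair⇓ fst⇓ (seq⇓ (pair⇓ true⇓ snd⇓) cons⇓))) r ,
    ≤-trans (+-monoʳ-≤ 11 t≤) (≤-trans (n≤1+n _) (n≤1+n _))
  size-unary : ∀ n bs → size (`list `bool) (unary n bs) ≡ 2 * n + size (`list `bool) bs
  size-unary zero    bs = refl
  size-unary (suc n) bs = trans (size-unary n (true ∷ bs)) (lemma n (size (`list `bool) bs))
    where
    lemma : ∀ n b → 2 * n + suc (suc b) ≡ 2 * suc n + b
    lemma = solve-∀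

-- Weighted sums

T⇒≡true : ∀ {b} → T b → b ≡ true
T⇒≡true {true} _ = refl

¬T⇒≡false : ∀ {b} → ¬ T b → b ≡ false
¬T⇒≡false {true}  ¬b = ⊥-elim (¬b _)
¬T⇒≡false {false} ¬b = refl

T-∧⁻ : ∀ {b c} → T (b ∧ c) → T b × T c
T-∧⁻ {true} {true} _ = _ , _

T-∧⁺ : ∀ {b c} → T b → T c → T (b ∧ c)
T-∧⁺ {true} {true} _ _ = _

T-not⁻ : ∀ {b} → T (not b) → b ≡ false
T-not⁻ {false} _ = refl

T-≡⁺ : ∀ {b c} → (T b → T c) → (T c → T b) → b ≡ c
T-≡⁺ {true}  {c}     f g = sym (T⇒≡true (f _))
T-≡⁺ {false} {true}  f g = ⊥-elim (g _)
T-≡⁺ {false} {false} f g = refl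

if-nonNeg : ∀ b {w} → 0ℚ ℚ.≤ w → 0ℚ ℚ.≤ (if b then w else 0ℚ)
if-nonNeg true  0≤w = 0≤w
if-nonNeg false 0≤w = ℚ.≤-refl

if-≤ : ∀ b {w} → 0ℚ ℚ.≤ w → (if b then w else 0ℚ) ℚ.≤ w
if-≤ true  0≤w = ℚ.≤-refl
if-≤ false 0≤w = 0≤w

module _ {A : Set} where

  filterᵇ-cong : ∀ {p q : A → Bool} xs → (∀ x → x ∈ xs → p x ≡ q x) → filterᵇ p xs ≡ filterᵇ q xs
  filterᵇ-cong []       p≗q = refl
  filterᵇ-cong {p} {q} (x ∷ xs) p≗q
    with p x | q x | p≗q x (here refl) | filterᵇ-cong {p} {q} xs (λ y y∈ → p≗q y (there y∈))
  ... | true  | true  | _ | ih = cong (x ∷_) ih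
  ... | false | false | _ | ih = ih

  filterᵇ-filterᵇ : ∀ {p q : A → Bool} xs → (∀ x → T (p x) → T (q x)) →
                    filterᵇ p (filterᵇ q xs) ≡ filterᵇ p xs
  filterᵇ-filterᵇ []       p⇒q = refl
  filterᵇ-filterᵇ {p} {q} (x ∷ xs) p⇒q with q x in qx
  ... | true  with p x
  ...   | true  = cong (x ∷_) (filterᵇ-filterᵇ xs p⇒q)
  ...   | false = filterᵇ-filterᵇ xs p⇒q
  filterᵇ-filterᵇ {p} {q} (x ∷ xs) p⇒q | false with p x in px
  ...   | true  = ⊥-elim (subst T qx (p⇒q x (subst T (sym px) _)))
  ...   | false = filterᵇ-filterᵇ xs p⇒q

  ∈-filterᵇ⁻ : ∀ (p : A → Bool) {x} xs → x ∈ filterᵇ p xs → x ∈ xs × T (p x)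
  ∈-filterᵇ⁻ p xs = ∈-filter⁻ (T? ∘ p) {xs = xs}

  ∑ : List A → (A → ℚ) → ℚ
  ∑ xs f = foldr (λ x s → f x ℚ.+ s) 0ℚ xs

  ∑-mono : ∀ xs {f g} → (∀ x → x ∈ xs → f x ℚ.≤ g x) → ∑ xs f ℚ.≤ ∑ xs g
  ∑-mono []       f≤g = ℚ.≤-refl
  ∑-mono (x ∷ xs) f≤g = ℚ.+-mono-≤ (f≤g x (here refl)) (∑-mono xs (λ y y∈ → f≤g y (there y∈)))

  ∑-cong : ∀ xs {f g} → (∀ x → x ∈ xs → f x ≡ g x) → ∑ xs f ≡ ∑ xs g
  ∑-cong []       f≗g = refl
  ∑-cong (x ∷ xs) f≗g = cong₂ ℚ._+_ (f≗g x (here refl)) (∑-cong xs (λ y y∈ → f≗g y (there y∈)))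

  ∑-0 : ∀ xs → ∑ xs (λ _ → 0ℚ) ≡ 0ℚ
  ∑-0 []       = refl
  ∑-0 (x ∷ xs) = trans (ℚ.+-identityˡ _) (∑-0 xs)

  ∑-nonNeg : ∀ xs {f} → (∀ x → 0ℚ ℚ.≤ f x) → 0ℚ ℚ.≤ ∑ xs f
  ∑-nonNeg xs 0≤f = ℚ.≤-trans (ℚ.≤-reflexive (sym (∑-0 xs))) (∑-mono xs (λ x _ → 0≤f x))

  ∑-filter : ∀ p xs {f} → (∀ x → x ∈ xs → p x ≡ false → f x ≡ 0ℚ) → ∑ (filterᵇ p xs) f ≡ ∑ xs f
  ∑-filter p []       p⇒0 = refl
  ∑-filter p (x ∷ xs) {f} p⇒0 with p x in px
  ... | true  = cong (f x ℚ.+_) (∑-filter p xs (λ y y∈ → p⇒0 y (there y∈)))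
  ... | false = begin
    ∑ (filterᵇ p xs) f  ≡⟨ ∑-filter p xs (λ y y∈ → p⇒0 y (there y∈)) ⟩
    ∑ xs f              ≡⟨ ℚ.+-identityˡ _ ⟨
    0ℚ ℚ.+ ∑ xs f       ≡⟨ cong (ℚ._+ ∑ xs f) (p⇒0 x (here refl) px) ⟨
    f x ℚ.+ ∑ xs f      ∎
    where open ≡-Reasoning

  ∑-partition : ∀ p xs f → ∑ xs f ≡ ∑ (filterᵇ p xs) f ℚ.+ ∑ (filterᵇ (not ∘ p) xs) f
  ∑-partition p []       f = sym (ℚ.+-identityˡ 0ℚ)
  ∑-partition p (x ∷ xs) f with p x
  ... | true  = trans (cong (f x ℚ.+_) (∑-partition p xs f)) (sym (ℚ.+-assoc (f x) _ _))
  ... | false = begin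
    f x ℚ.+ ∑ xs f     ≡⟨ cong (f x ℚ.+_) (∑-partition p xs f) ⟩
    f x ℚ.+ (a ℚ.+ b)  ≡⟨ ℚ.+-assoc (f x) a b ⟨
    f x ℚ.+ a ℚ.+ b    ≡⟨ cong (ℚ._+ b) (ℚ.+-comm (f x) a) ⟩
    a ℚ.+ f x ℚ.+ b    ≡⟨ ℚ.+-assoc a (f x) b ⟩
    a ℚ.+ (f x ℚ.+ b)  ∎
    where
    open ≡-Reasoning
    a = ∑ (filterᵇ p xs) f
    b = ∑ (filterᵇ (not ∘ p) xs) f

  ∑-+ : ∀ xs f g → ∑ xs (λ x → f x ℚ.+ g x) ≡ ∑ xs f ℚ.+ ∑ xs g
  ∑-+ []       f g = sym (ℚ.+-identityˡ 0ℚ)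
  ∑-+ (x ∷ xs) f g = begin
    f x ℚ.+ g x ℚ.+ ∑ xs (λ x → f x ℚ.+ g x)  ≡⟨ cong (f x ℚ.+ g x ℚ.+_) (∑-+ xs f g) ⟩
    f x ℚ.+ g x ℚ.+ (∑ xs f ℚ.+ ∑ xs g)       ≡⟨ interchange (f x) (g x) _ _ ⟩
    f x ℚ.+ ∑ xs f ℚ.+ (g x ℚ.+ ∑ xs g)       ∎
    where open ≡-Reasoning

  ∑-const : ∀ xs c → ∑ xs (λ _ → c) ≡ length xs · c
  ∑-const []       c = refl
  ∑-const (x ∷ xs) c = cong (c ℚ.+_) (∑-const xs c)

∑-swap : ∀ {A B : Set} (xs : List A) (ys : List B) (f : A → B → ℚ) →
         ∑ xs (λ x → ∑ ys (f x)) ≡ ∑ ys (λ y → ∑ xs (λ x → f x y))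
∑-swap []       ys f = sym (∑-0 ys)
∑-swap (x ∷ xs) ys f = trans (cong (∑ ys (f x) ℚ.+_) (∑-swap xs ys f))
                             (sym (∑-+ ys (f x) (λ y → ∑ xs (λ x → f x y))))

module _ {A : Set} (same : A → A → Bool)
         (same-sym : ∀ u v → T (same u v) → T (same v u))
         (same-trans : ∀ u v w → T (same u v) → T (same v w) → T (same u w)) where

  -- Equality of lists, order included, is what makes the searches started from different vertices
  -- of a class return the same set.
  filterᵇ-class : ∀ u v xs → T (same u v) → filterᵇ (same u) xs ≡ filterᵇ (same v) xs
  filterᵇ-class u v xs uv = filterᵇ-cong xs λ x _ →
    T-≡⁺ (same-trans v u x (same-sym u v uv)) (same-trans u v x uv)

  -- The whole class of the head is removed at once, hence the induction on a length bound; by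
  -- transitivity the other classes keep their lists. An element unrelated to itself lies in no
  -- class and is compared pointwise.
  ∑-classes : ∀ n xs → length xs ≤ n → ∀ {f g} →
    (∀ v → same v v ≡ false → f v ℚ.≤ g v) →
    (∀ v → v ∈ xs → ∑ (filterᵇ (same v) xs) f ℚ.≤ ∑ (filterᵇ (same v) xs) g) →
    ∑ xs f ℚ.≤ ∑ xs g
  ∑-classes n       []       len           out cls = ℚ.≤-refl
  ∑-classes (suc n) (x ∷ xs) (s≤s len) {f} {g} out cls with same x x in xx
  ... | false = ℚ.+-mono-≤ (out x xx) (∑-classes n xs len out λ v v∈ →
          subst (λ ys → ∑ ys f ℚ.≤ ∑ ys g) (skip v) (cls v (there v∈)))
    where
    skip : ∀ v → filterᵇ (same v) (x ∷ xs) ≡ filterᵇ (same v) xs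
    skip v with same v x in vx
    ... | true  = ⊥-elim (subst T xx
                    (same-trans x v x (same-sym v x (subst T (sym vx) _)) (subst T (sym vx) _)))
    ... | false = refl
  ... | true = begin
    ∑ (x ∷ xs) f                                    ≡⟨ ∑-partition (same x) (x ∷ xs) f ⟩
    ∑ (filterᵇ (same x) (x ∷ xs)) f ℚ.+ ∑ others f  ≤⟨ ℚ.+-mono-≤ (cls x (here refl)) others≤ ⟩
    ∑ (filterᵇ (same x) (x ∷ xs)) g ℚ.+ ∑ others g  ≡⟨ ∑-partition (same x) (x ∷ xs) g ⟨
    ∑ (x ∷ xs) g                                    ∎
    where
    open ℚ.≤-Reasoning
    others = filterᵇ (not ∘ same x) (x ∷ xs)
    others-len : length others ≤ n
    others-len rewrite xx = ≤-trans (length-filter (T? ∘ not ∘ same x) xs) len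
    others≤ : ∑ others f ℚ.≤ ∑ others g
    others≤ = ∑-classes n others others-len out λ v v∈ →
      let v∈xs , ¬xv = ∈-filterᵇ⁻ (not ∘ same x) (x ∷ xs) v∈ in
      subst (λ ys → ∑ ys f ℚ.≤ ∑ ys g)
            (sym (filterᵇ-filterᵇ (x ∷ xs) (disjoint v (T-not⁻ ¬xv))))
            (cls v v∈xs)
      where
      disjoint : ∀ v → same x v ≡ false → ∀ y → T (same v y) → T (not (same x y))
      disjoint v ¬xv y vy with same x y in xy
      ... | false = _
      ... | true  = subst T ¬xv (same-trans x y v (subst T (sym xy) _) (same-sym v y vy))

-- At the failing index a term of at most `a` is lost, and from there on `ok` always holds. In the
-- application `r` is survival in the other coordinates, so losses are charged one coordinate at a
-- time.
∑-at-most-one-failure : ∀ {X : Set} (ok r : X → Bool) {a} → 0ℚ ℚ.≤ a → ∀ xs → Unique xs →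
  (∀ x y → x ∈ xs → y ∈ xs → ok x ≡ false → ok y ≡ false → x ≡ y) →
  ∑ xs (λ x → if r x then a else 0ℚ) ℚ.≤ ∑ xs (λ x → if ok x ∧ r x then a else 0ℚ) ℚ.+ a
∑-at-most-one-failure ok r {a} 0≤a [] uniq once = ℚ.≤-trans 0≤a (ℚ.≤-reflexive (sym (ℚ.+-identityˡ a)))
∑-at-most-one-failure ok r {a} 0≤a (x ∷ xs) (x∉ ∷ uniq) once with ok x in okx
... | true  = ℚ.≤-trans
  (ℚ.+-monoʳ-≤ (if r x then a else 0ℚ)
    (∑-at-most-one-failure ok r 0≤a xs uniq (λ y z y∈ z∈ → once y z (there y∈) (there z∈))))
  (ℚ.≤-reflexive (sym (ℚ.+-assoc (if r x then a else 0ℚ) _ _)))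
... | false = begin
    (if r x then a else 0ℚ) ℚ.+ ∑ xs (λ y → if r y then a else 0ℚ)
      ≤⟨ ℚ.+-monoˡ-≤ _ (if-≤ (r x) 0≤a) ⟩
    a ℚ.+ ∑ xs (λ y → if r y then a else 0ℚ)
      ≡⟨ cong (a ℚ.+_) (∑-cong xs λ y y∈ → cong (λ b → if b ∧ r y then a else 0ℚ) (sym (holds y y∈))) ⟩
    a ℚ.+ ∑ xs (λ y → if ok y ∧ r y then a else 0ℚ)
      ≡⟨ ℚ.+-comm a _ ⟩
    ∑ xs (λ y → if ok y ∧ r y then a else 0ℚ) ℚ.+ a
      ≡⟨ cong (ℚ._+ a) (ℚ.+-identityˡ (∑ xs (λ y → if ok y ∧ r y then a else 0ℚ))) ⟨
    0ℚ ℚ.+ ∑ xs (λ y → if ok y ∧ r y then a else 0ℚ) ℚ.+ a ∎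
  where
  open ℚ.≤-Reasoning
  holds : ∀ y → y ∈ xs → ok y ≡ true
  holds y y∈ with ok y in oky
  ... | true  = refl
  ... | false = ⊥-elim (All.lookup x∉ y∈ (once x y (here refl) (there y∈) okx oky))

-- Exhaustive search inside the classes of a partial equivalence relation

-- `≤ℕ` is the only comparison of naturals in the language.
eqᵇ : ℕ → ℕ → Bool
eqᵇ m n = (m ≤ᵇ n) ∧ (n ≤ᵇ m)

eqᵇ⇒≡ : ∀ m n → T (eqᵇ m n) → m ≡ n
eqᵇ⇒≡ m n eq = let m≤n , n≤m = T-∧⁻ eq in ≤-antisym (≤ᵇ⇒≤ m n m≤n) (≤ᵇ⇒≤ n m n≤m)

eqᵇ-refl : ∀ m → T (eqᵇ m m)
eqᵇ-refl m = T-∧⁺ (≤⇒≤ᵇ (≤-refl {m})) (≤⇒≤ᵇ (≤-refl {m}))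

module Algorithm {A : Set} (key : A → ℕ) (adj : A → A → Bool) (wt : A → ℚ) where

  member : A → List A → Bool
  member a xs = foldr (λ x b → if eqᵇ (key a) (key x) then true else b) false xs

  better : ℚ × List A → ℚ × List A → ℚ × List A
  better p q = if proj₁ p ℚ.≤ᵇ proj₁ q then q else p

  extend : A → ℚ × List A → ℚ × List A
  extend x r = wt x ℚ.+ proj₁ r , x ∷ proj₂ r

  avoid : A → List A → List A
  avoid x = filterᵇ (λ y → not (adj x y))

  -- Optimal only on lists of length at most k, the branching depth.
  mis : ℕ → List A → ℚ × List A
  mis zero    xs = 0ℚ , []
  mis (suc k) xs = caseList (0ℚ , []) (λ x xs → better (mis k xs) (extend x (mis k (avoid x xs)))) xs

  -- A vertex not related to itself is missing from its own filtered list and is therefore never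
  -- chosen.
  chosen : ℕ → (A → A → Bool) → List A → A → Bool
  chosen k same xs v = member v (proj₂ (mis k (filterᵇ (same v) xs)))

  -- The weights are kept beside the bits so that a candidate can be weighed on its own.
  choose : ℕ → (A → A → Bool) → List A → List (Bool × ℚ)
  choose k same xs = map (λ v → chosen k same xs v , wt v) xs

  better-elim : ∀ (P : ℚ × List A → Set) p q → P p → P q → P (better p q)
  better-elim P p q Pp Pq with proj₁ p ℚ.≤ᵇ proj₁ q
  ... | true  = Pq
  ... | false = Pp

  better-≥ˡ : ∀ p q → proj₁ p ℚ.≤ proj₁ (better p q)
  better-≥ˡ p q with proj₁ p ℚ.≤ᵇ proj₁ q in p≤q
  ... | true  = ℚ.≤ᵇ⇒≤ (subst T (sym p≤q) _)
  ... | false = ℚ.≤-refl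

  better-≥ʳ : ∀ p q → proj₁ q ℚ.≤ proj₁ (better p q)
  better-≥ʳ p q with proj₁ p ℚ.≤ᵇ proj₁ q in p≤q
  ... | true  = ℚ.≤-refl
  ... | false with ℚ.≤-total (proj₁ p) (proj₁ q)
  ...   | inj₁ p≤ = ⊥-elim (subst T p≤q (ℚ.≤⇒≤ᵇ p≤))
  ...   | inj₂ q≤ = q≤

  module Correctness
    (key-injective : ∀ {u v} → key u ≡ key v → u ≡ v)
    (adj-sym : ∀ u v → adj u v ≡ adj v u)
    (adj-irr : ∀ v → adj v v ≡ false)
    (wt≥0 : ∀ v → 0ℚ ℚ.≤ wt v) where

    member⇒∈ : ∀ v xs → T (member v xs) → v ∈ xs
    member⇒∈ v (x ∷ xs) m with eqᵇ (key v) (key x) in eq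
    ... | true  = here (key-injective (eqᵇ⇒≡ (key v) (key x) (subst T (sym eq) _)))
    ... | false = there (member⇒∈ v xs m)

    ∈⇒member : ∀ v xs → v ∈ xs → T (member v xs)
    ∈⇒member v (x ∷ xs) v∈ with eqᵇ (key v) (key x) in eq
    ∈⇒member v (x ∷ xs) v∈         | true  = _
    ∈⇒member v (x ∷ xs) (here refl) | false = ⊥-elim (subst T eq (eqᵇ-refl (key v)))
    ∈⇒member v (x ∷ xs) (there v∈) | false = ∈⇒member v xs v∈

    mis-⊆ : ∀ k xs {v} → v ∈ proj₂ (mis k xs) → v ∈ xs
    mis-⊆ (suc k) (x ∷ xs) {v} = better-elim (λ r → v ∈ proj₂ r → v ∈ x ∷ xs)
      (mis k xs) (extend x (mis k (avoid x xs)))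
      (λ v∈ → there (mis-⊆ k xs v∈))
      λ where
        (here refl) → here refl
        (there v∈)  → there (proj₁ (∈-filterᵇ⁻ (λ y → not (adj x y)) xs (mis-⊆ k _ v∈)))

    mis-independent : ∀ k xs {u v} → u ∈ proj₂ (mis k xs) → v ∈ proj₂ (mis k xs) → adj u v ≡ false
    mis-independent (suc k) (x ∷ xs) {u} {v} =
      better-elim (λ r → u ∈ proj₂ r → v ∈ proj₂ r → adj u v ≡ false)
        (mis k xs) (extend x (mis k (avoid x xs)))
        (mis-independent k xs)
        λ where
          (here refl) (here refl) → adj-irr x
          (here refl) (there v∈)  → nonadjacent v∈
          (there u∈)  (here refl) → trans (adj-sym u x) (nonadjacent u∈)
          (there u∈)  (there v∈)  → mis-independent k _ u∈ v∈
      where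
      nonadjacent : ∀ {y} → y ∈ proj₂ (mis k (avoid x xs)) → adj x y ≡ false
      nonadjacent y∈ = T-not⁻ (proj₂ (∈-filterᵇ⁻ (λ y → not (adj x y)) xs (mis-⊆ k _ y∈)))

    -- Uniqueness enters twice: the head is not among the vertices chosen from the tail, and no tail
    -- vertex is taken for the head by `member`.
    mis-weight : ∀ k xs → Unique xs →
      proj₁ (mis k xs) ≡ ∑ xs (λ v → if member v (proj₂ (mis k xs)) then wt v else 0ℚ)
    mis-weight zero    xs       uniq = sym (∑-0 xs)
    mis-weight (suc k) []       uniq = refl
    mis-weight (suc k) (x ∷ xs) (x∉ ∷ uniq) =
      better-elim (λ r → proj₁ r ≡ ∑ (x ∷ xs) (λ v → if member v (proj₂ r) then wt v else 0ℚ))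
        (mis k xs) (extend x (mis k ws))
        without with-x
      where
      open ≡-Reasoning
      ws = avoid x xs
      ys = proj₂ (mis k xs)
      zs = proj₂ (mis k ws)
      weigh : List A → A → ℚ
      weigh us v = if member v us then wt v else 0ℚ
      absent : ∀ v us → v ∉ us → member v us ≡ false
      absent v us v∉ = ¬T⇒≡false (v∉ ∘ member⇒∈ v us)
      without : proj₁ (mis k xs) ≡ weigh ys x ℚ.+ ∑ xs (weigh ys)
      without = begin
        proj₁ (mis k xs)        ≡⟨ mis-weight k xs uniq ⟩
        ∑ xs (weigh ys)         ≡⟨ ℚ.+-identityˡ _ ⟨
        0ℚ ℚ.+ ∑ xs (weigh ys)  ≡⟨ cong (λ b → (if b then wt x else 0ℚ) ℚ.+ ∑ xs (weigh ys))
                                          (absent x ys (λ x∈ → All.lookup x∉ (mis-⊆ k xs x∈) refl)) ⟨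
        weigh ys x ℚ.+ ∑ xs (weigh ys) ∎
      old : ∀ v → v ∈ xs → member v (x ∷ zs) ≡ member v zs
      old v v∈ with eqᵇ (key v) (key x) in eq
      ... | true  = ⊥-elim (All.lookup x∉ v∈ (sym (key-injective (eqᵇ⇒≡ (key v) (key x) (subst T (sym eq) _)))))
      ... | false = refl
      with-x : wt x ℚ.+ proj₁ (mis k ws) ≡ weigh (x ∷ zs) x ℚ.+ ∑ xs (weigh (x ∷ zs))
      with-x = cong₂ ℚ._+_
        (cong (λ b → if b then wt x else 0ℚ) (sym (T⇒≡true (∈⇒member x (x ∷ zs) (here refl)))))
        (begin
          proj₁ (mis k ws)  ≡⟨ mis-weight k ws (Unique.filter⁺ (λ y → T? (not (adj x y))) uniq) ⟩
          ∑ ws (weigh zs)   ≡⟨ ∑-filter (λ y → not (adj x y)) xs (λ v _ ¬v →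
                                     cong (λ b → if b then wt v else 0ℚ) (absent v zs (λ v∈ → subst T ¬v
                                       (proj₂ (∈-filterᵇ⁻ (λ y → not (adj x y)) xs (mis-⊆ k ws v∈)))))) ⟩
          ∑ xs (weigh zs)        ≡⟨ ∑-cong xs (λ v v∈ → cong (λ b → if b then wt v else 0ℚ) (old v v∈)) ⟨
          ∑ xs (weigh (x ∷ zs))  ∎)

    IndependentSet : (A → Bool) → Set
    IndependentSet P = ∀ u v → T (P u) → T (P v) → adj u v ≡ false

    -- If `P` contains the head, independence lets all its other members pass `avoid`, so the branch
    -- that takes the head loses nothing of `P`; otherwise the branch that drops the head loses
    -- nothing.
    mis-maximum : ∀ k xs → length xs ≤ k → ∀ P → IndependentSet P →
      ∑ xs (λ v → if P v then wt v else 0ℚ) ℚ.≤ proj₁ (mis k xs)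
    mis-maximum zero    []       len       P ind = ℚ.≤-refl
    mis-maximum (suc k) []       len       P ind = ℚ.≤-refl
    mis-maximum (suc k) (x ∷ xs) (s≤s len) P ind with P x in Px
    ... | false = ℚ.≤-trans (ℚ.≤-reflexive (ℚ.+-identityˡ _))
                    (ℚ.≤-trans (mis-maximum k xs len P ind)
                               (better-≥ˡ (mis k xs) (extend x (mis k (avoid x xs)))))
    ... | true  = ℚ.≤-trans
      (ℚ.+-monoʳ-≤ (wt x) (ℚ.≤-trans
        (ℚ.≤-reflexive (sym (∑-filter (λ y → not (adj x y)) xs excluded)))
        (mis-maximum k _ (≤-trans (length-filter (λ y → T? (not (adj x y))) xs) len) P ind)))
      (better-≥ʳ (mis k xs) (extend x (mis k (avoid x xs))))
      where
      excluded : ∀ v → v ∈ xs → not (adj x v) ≡ false → (if P v then wt v else 0ℚ) ≡ 0ℚ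
      excluded v _ adjacent with P v in Pv
      ... | false = refl
      ... | true  = ⊥-elim (subst T (trans (cong not (sym nonadjacent)) adjacent) _)
        where
        nonadjacent : adj x v ≡ false
        nonadjacent = ind x v (subst T (sym Px) _) (subst T (sym Pv) _)

    -- `same v v` means that `v` is not discarded, which is why `adj⇒same` asks it of both
    -- endpoints: adjacent vertices of different cells exist, but a margin contains one of them.
    module Shifted (same : A → A → Bool)
      (same-sym : ∀ u v → T (same u v) → T (same v u))
      (same-trans : ∀ u v w → T (same u v) → T (same v w) → T (same u w))
      (adj⇒same : ∀ u v → T (adj u v) → T (same u u) → T (same v v) → T (same u v))
      (V : List A) (V-unique : Unique V) (k : ℕ)
      (class-size : ∀ v → length (filterᵇ (same v) V) ≤ k) where

      chosen-same : ∀ v → T (chosen k same V v) → T (same v v)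
      chosen-same v c = proj₂ (∈-filterᵇ⁻ (same v) V (mis-⊆ k _ (member⇒∈ v _ c)))

      -- An edge between chosen vertices would put them into one class, hence into the output of one
      -- search.
      chosen-independent : IndependentSet (chosen k same V)
      chosen-independent u v cu cv = ¬T⇒≡false λ uv →
        let u~v = adj⇒same u v uv (chosen-same u cu) (chosen-same v cv)
            u∈  = subst (λ c → u ∈ proj₂ (mis k c))
                    (filterᵇ-class same same-sym same-trans u v V u~v) (member⇒∈ u _ cu)
        in subst T (mis-independent k _ u∈ (member⇒∈ v _ cv)) uv

      chosen-weight : ∀ P → IndependentSet P →
        ∑ V (λ v → if same v v then (if P v then wt v else 0ℚ) else 0ℚ) ℚ.≤
        ∑ V (λ v → if chosen k same V v then wt v else 0ℚ)
      chosen-weight P ind = ∑-classes same same-sym same-trans (length V) V ≤-refl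
        (λ v ¬vv → ℚ.≤-trans (ℚ.≤-reflexive (cong (λ b → if b then (if P v then wt v else 0ℚ) else 0ℚ) ¬vv))
                           (if-nonNeg (chosen k same V v) (wt≥0 v)))
        (λ v v∈ → let C = filterᵇ (same v) V in begin
          ∑ C (λ u → if same u u then (if P u then wt u else 0ℚ) else 0ℚ)
            ≤⟨ ∑-mono C (λ u _ → if-≤ (same u u) (if-nonNeg (P u) (wt≥0 u))) ⟩
          ∑ C (λ u → if P u then wt u else 0ℚ)
            ≤⟨ mis-maximum k C (class-size v) P ind ⟩
          proj₁ (mis k C)
            ≡⟨ mis-weight k C (Unique.filter⁺ (T? ∘ same v) V-unique) ⟩
          ∑ C (λ u → if member u (proj₂ (mis k C)) then wt u else 0ℚ)
            -- The search from `v` is exchanged, for each `u` of the class, for the search from `u`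
            -- that `chosen` performs.
            ≡⟨ ∑-cong C (λ u u∈ → cong (λ D → if member u (proj₂ (mis k D)) then wt u else 0ℚ)
                 (filterᵇ-class same same-sym same-trans v u V (proj₂ (∈-filterᵇ⁻ (same v) V u∈)))) ⟩
          ∑ C (λ u → if chosen k same V u then wt u else 0ℚ) ∎)
        where open ℚ.≤-Reasoning

-- Transport of the search along an encoding

module Naturality {A B : Set} (enc : A → B)
  {keyA : A → ℕ} {adjA : A → A → Bool} {wtA : A → ℚ}
  {keyB : B → ℕ} {adjB : B → B → Bool} {wtB : B → ℚ}
  (key≡ : ∀ a → keyB (enc a) ≡ keyA a)
  (adj≡ : ∀ a b → adjB (enc a) (enc b) ≡ adjA a b)
  (wt≡ : ∀ a → wtB (enc a) ≡ wtA a) where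

  private
    module A = Algorithm keyA adjA wtA
    module B = Algorithm keyB adjB wtB

  filterᵇ-map : ∀ {p : B → Bool} {q : A → Bool} → (∀ a → p (enc a) ≡ q a) → ∀ xs →
                filterᵇ p (map enc xs) ≡ map enc (filterᵇ q xs)
  filterᵇ-map p≡q []       = refl
  filterᵇ-map {p} {q} p≡q (x ∷ xs) with p (enc x) | q x | p≡q x
  ... | true  | true  | _ = cong (enc x ∷_) (filterᵇ-map p≡q xs)
  ... | false | false | _ = filterᵇ-map p≡q xs

  member-map : ∀ a xs → B.member (enc a) (map enc xs) ≡ A.member a xs
  member-map a []       = refl
  -- The induction hypothesis brings `keyB (enc a)` back, hence the second rewriting by `key≡ a`.
  member-map a (x ∷ xs) rewrite key≡ a | key≡ x | sym (member-map a xs) | key≡ a = refl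

  better-map : ∀ w xs w′ ys → B.better (w , map enc xs) (w′ , map enc ys) ≡
               (proj₁ (A.better (w , xs) (w′ , ys)) , map enc (proj₂ (A.better (w , xs) (w′ , ys))))
  better-map w xs w′ ys with w ℚ.≤ᵇ w′
  ... | true  = refl
  ... | false = refl

  -- The search inspects vertices only through adjacency and weight, both preserved by `enc`, so it
  -- branches identically on both sides.
  mis-map : ∀ k xs → B.mis k (map enc xs) ≡ (proj₁ (A.mis k xs) , map enc (proj₂ (A.mis k xs)))
  mis-map zero    xs       = refl
  mis-map (suc k) []       = refl
  mis-map (suc k) (x ∷ xs)
    rewrite filterᵇ-map {λ y → not (adjB (enc x) y)} {λ y → not (adjA x y)} (λ a → cong not (adj≡ x a)) xs
          | mis-map k xs | mis-map k (A.avoid x xs) | wt≡ x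
    = better-map (proj₁ (A.mis k xs)) (proj₂ (A.mis k xs)) _ (x ∷ _)

  choose-map : ∀ k {sameA : A → A → Bool} {sameB : B → B → Bool} →
    (∀ a b → sameB (enc a) (enc b) ≡ sameA a b) → ∀ xs →
    B.choose k sameB (map enc xs) ≡ A.choose k sameA xs
  choose-map k {sameA} {sameB} same≡ xs = go xs
    where
    chosen≡ : ∀ v → B.chosen k sameB (map enc xs) (enc v) ≡ A.chosen k sameA xs v
    chosen≡ v rewrite filterᵇ-map {sameB (enc v)} {sameA v} (same≡ v) xs
                    | mis-map k (filterᵇ (sameA v) xs) = member-map v (proj₂ (A.mis k (filterᵇ (sameA v) xs)))
    go : ∀ ys → map (λ v → B.chosen k sameB (map enc xs) v , wtB v) (map enc ys) ≡
                map (λ v → A.chosen k sameA xs v , wtA v) ys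
    go []       = refl
    go (y ∷ ys) = cong₂ _∷_ (cong₂ _,_ (chosen≡ y) (wt≡ y)) (go ys)

-- The best of finitely many candidates

argmax : {X : Set} → (X → ℚ) → (ℕ → X) → ℕ → X
argmax w s zero    = s zero
argmax w s (suc j) = if w (argmax w s j) ℚ.≤ᵇ w (s (suc j)) then s (suc j) else argmax w s j

argmax-attained : ∀ {X : Set} (w : X → ℚ) s j → ∃ λ i → i ≤ j × argmax w s j ≡ s i
argmax-attained w s zero    = zero , z≤n , refl
argmax-attained w s (suc j) with w (argmax w s j) ℚ.≤ᵇ w (s (suc j))
... | true  = suc j , ≤-refl , refl
... | false = let i , i≤j , eq = argmax-attained w s j in i , m≤n⇒m≤1+n i≤j , eq

argmax-max : ∀ {X : Set} (w : X → ℚ) s j {i} → i ≤ j → w (s i) ℚ.≤ w (argmax w s j)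
argmax-max w s zero    z≤n = ℚ.≤-refl
argmax-max w s (suc j) {i} i≤ with w (argmax w s j) ℚ.≤ᵇ w (s (suc j)) in eq | m≤n⇒m<n∨m≡n i≤
... | true  | inj₂ refl      = ℚ.≤-refl
... | true  | inj₁ (s≤s i≤j) = ℚ.≤-trans (argmax-max w s j i≤j) (ℚ.≤ᵇ⇒≤ (subst T (sym eq) _))
... | false | inj₁ (s≤s i≤j) = argmax-max w s j i≤j
... | false | inj₂ refl with ℚ.≤-total (w (argmax w s j)) (w (s (suc j)))
...   | inj₁ ≤s = ⊥-elim (subst T eq (ℚ.≤⇒≤ᵇ ≤s))
...   | inj₂ s≤ = s≤

-- Cells

funToFin-injective : ∀ {m n} (f g : Fin m → Fin n) → Fin.funToFin f ≡ Fin.funToFin g → ∀ i → f i ≡ g i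
funToFin-injective f g eq i = begin
  f i                              ≡⟨ finToFun-funToFin f i ⟨
  Fin.finToFun (Fin.funToFin f) i  ≡⟨ cong (λ z → Fin.finToFun z i) eq ⟩
  Fin.finToFun (Fin.funToFin g) i  ≡⟨ finToFun-funToFin g i ⟩
  g i                              ∎
  where open ≡-Reasoning

Unique⇒length≤ : ∀ {A : Set} {k} (f : A → Fin k) xs → Unique xs →
                 (∀ {u v} → u ∈ xs → v ∈ xs → f u ≡ f v → u ≡ v) → length xs ≤ k
Unique⇒length≤ f xs uniq inj = injective⇒≤ {f = f ∘ List.lookup xs} λ {i} {j} eq →
  lookup-injective xs uniq i j (inj (∈-lookup i) (∈-lookup j) eq)
  where
  lookup-injective : ∀ xs → Unique xs → ∀ i j → List.lookup xs i ≡ List.lookup xs j → i ≡ j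
  lookup-injective (x ∷ xs) (x∉ ∷ uniq) zero    zero    eq = refl
  lookup-injective (x ∷ xs) (x∉ ∷ uniq) zero    (suc j) eq = ⊥-elim (All.lookup x∉ (∈-lookup j) eq)
  lookup-injective (x ∷ xs) (x∉ ∷ uniq) (suc i) zero    eq = ⊥-elim (All.lookup x∉ (∈-lookup i) (sym eq))
  lookup-injective (x ∷ xs) (x∉ ∷ uniq) (suc i) (suc j) eq = cong suc (lookup-injective xs uniq i j eq)

-- Coordinates are cut into cells of length suc l, displaced by s; the first w positions of
-- each cell form its margin.

module Cells (w l : ℕ) where

  -- The language has no division: quotient and remainder of `x + s` by `suc l` are found by ticking
  -- `x` times from `(0 , s)`, the remainder wrapping at `l`.
  tick : ℕ × ℕ → ℕ × ℕ
  tick a = if l ≤ᵇ proj₂ a then (suc (proj₁ a) , 0) else (proj₁ a , suc (proj₂ a))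

  cell : ℕ → ℕ → ℕ × ℕ
  cell s x = foldl (λ a _ → tick a) (0 , s) (unary x [])

  quot rem : ℕ → ℕ → ℕ
  quot s x = proj₁ (cell s x)
  rem  s x = proj₂ (cell s x)

  tick-spec : ∀ q r → r ≤ l → let q′ , r′ = tick (q , r) in
              q′ * suc l + r′ ≡ suc (q * suc l + r) × r′ ≤ l
  tick-spec q r r≤l with l ≤ᵇ r in eq
  ... | true with refl ← ≤-antisym r≤l (≤ᵇ⇒≤ l r (subst T (sym eq) _)) = lemma q r , z≤n
    where
    lemma : ∀ q l → suc q * suc l + 0 ≡ suc (q * suc l + l)
    lemma = solve-∀
  ... | false = +-suc (q * suc l) r , ≰⇒> λ l≤r → subst T eq (≤⇒≤ᵇ l≤r)

  ticks-spec : ∀ (bs : List Bool) q r → r ≤ l → let q′ , r′ = foldl (λ a _ → tick a) (q , r) bs in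
               q′ * suc l + r′ ≡ length bs + (q * suc l + r) × r′ ≤ l
  ticks-spec []       q r r≤l = refl , r≤l
  ticks-spec (b ∷ bs) q r r≤l =
    let eq , r′≤l = tick-spec q r r≤l
        eq′ , r″≤l = ticks-spec bs _ _ r′≤l
    in trans eq′ (trans (cong (length bs +_) eq) (+-suc (length bs) _)) , r″≤l

  cell-spec : ∀ {s} x → s ≤ l → quot s x * suc l + rem s x ≡ x + s
  cell-spec {s} x s≤l = trans (proj₁ (ticks-spec (unary x []) 0 s s≤l))
    (cong (_+ s) (trans (length-unary x []) (+-identityʳ x)))

  rem≤ : ∀ {s} x → s ≤ l → rem s x ≤ l
  rem≤ {s} x s≤l = proj₂ (ticks-spec (unary x []) 0 s s≤l)

  interior : ℕ → ℕ → Bool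
  interior s x = w ≤ᵇ rem s x

  -- Requiring both points to be interior makes this a partial equivalence whose diagonal marks the
  -- points that are kept. It works on lists because the program does; `SameCell` is its counterpart
  -- for reasoning.
  sameCell : ℕ → ℕ → List ℕ → List ℕ → Bool
  sameCell s zero    xs ys = true
  sameCell s (suc d) xs ys = caseList false (λ x xs → caseList false (λ y ys →
    interior s x ∧ (interior s y ∧ (eqᵇ (quot s x) (quot s y) ∧ sameCell s d xs ys))) ys) xs

  SameCell : ℕ → ∀ {d} → Vec ℕ d → Vec ℕ d → Set
  SameCell s xs ys = ∀ i → w ≤ rem s (lookup xs i) × w ≤ rem s (lookup ys i) ×
                           quot s (lookup xs i) ≡ quot s (lookup ys i)

  sameCell⇒SameCell : ∀ s {d} (xs ys : Vec ℕ d) → T (sameCell s d (toList xs) (toList ys)) → SameCell s xs ys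
  sameCell⇒SameCell s (x ∷ xs) (y ∷ ys) t zero =
    let wx , t′ = T-∧⁻ {interior s x} t
        wy , t″ = T-∧⁻ {interior s y} t′
        q  , _  = T-∧⁻ {eqᵇ (quot s x) (quot s y)} t″
    in ≤ᵇ⇒≤ w _ wx , ≤ᵇ⇒≤ w _ wy , eqᵇ⇒≡ _ _ q
  sameCell⇒SameCell s (x ∷ xs) (y ∷ ys) t (suc i) =
    let _ , t′ = T-∧⁻ {interior s x} t
        _ , t″ = T-∧⁻ {interior s y} t′
        _ , t‴ = T-∧⁻ {eqᵇ (quot s x) (quot s y)} t″
    in sameCell⇒SameCell s xs ys t‴ i

  SameCell⇒sameCell : ∀ s {d} (xs ys : Vec ℕ d) → SameCell s xs ys → T (sameCell s d (toList xs) (toList ys))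
  SameCell⇒sameCell s []       []       same = _
  SameCell⇒sameCell s (x ∷ xs) (y ∷ ys) same =
    let wx , wy , q = same zero in
    T-∧⁺ (≤⇒≤ᵇ wx) (T-∧⁺ (≤⇒≤ᵇ wy)
      (T-∧⁺ (subst (λ z → T (eqᵇ (quot s x) z)) q (eqᵇ-refl (quot s x)))
            (SameCell⇒sameCell s xs ys (λ i → same (suc i)))))

  sameCell-diagonal : ∀ s d x xs → sameCell s (suc d) (x ∷ xs) (x ∷ xs) ≡ interior s x ∧ sameCell s d xs xs
  sameCell-diagonal s d x xs with interior s x
  ... | false = refl
  ... | true  = cong (_∧ sameCell s d xs xs) (T⇒≡true (eqᵇ-refl (quot s x)))

  -- Between a point and an interior point of a later cell lies the whole margin of the latter cell,
  -- of length `w`.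
  quot<⇒far : ∀ {s} → s ≤ l → ∀ x y → quot s x < quot s y → w ≤ rem s y → ¬ y < x + w
  quot<⇒far {s} s≤l x y lt wy y<x+w = <-irrefl refl (begin-strict
    y + s                              <⟨ +-monoˡ-< s y<x+w ⟩
    x + w + s                          ≡⟨ shuffle x w s ⟩
    x + s + w                          ≡⟨ cong (_+ w) (cell-spec x s≤l) ⟨
    quot s x * suc l + rem s x + w     ≤⟨ +-monoˡ-≤ w (+-monoʳ-≤ (quot s x * suc l) (m≤n⇒m≤1+n (rem≤ x s≤l))) ⟩
    quot s x * suc l + suc l + w       ≡⟨ cong (_+ w) (+-comm (quot s x * suc l) (suc l)) ⟩
    suc (quot s x) * suc l + w         ≤⟨ +-mono-≤ (*-monoˡ-≤ (suc l) lt) wy ⟩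
    quot s y * suc l + rem s y         ≡⟨ cell-spec y s≤l ⟩
    y + s                              ∎)
    where
    open ≤-Reasoning
    shuffle : ∀ x w s → x + w + s ≡ x + s + w
    shuffle = solve-∀

  near⇒quot≡ : ∀ {s} → s ≤ l → ∀ x y → ∣ x - y ∣ < w → w ≤ rem s x → w ≤ rem s y → quot s x ≡ quot s y
  near⇒quot≡ {s} s≤l x y near wx wy with <-cmp (quot s x) (quot s y)
  ... | tri≈ _ eq _ = eq
  ... | tri< lt _ _ = ⊥-elim (quot<⇒far s≤l x y lt wy (≤-<-trans (m≤n+∣n-m∣ y x) (+-monoʳ-< x near)))
  ... | tri> _ _ gt = ⊥-elim (quot<⇒far s≤l y x gt wx (≤-<-trans (m≤n+∣m-n∣ x y) (+-monoʳ-< y near)))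

  near⇒SameCell : ∀ {s} → s ≤ l → ∀ {d} (xs ys : Vec ℕ d) → (∀ i → ∣ lookup xs i - lookup ys i ∣ < w) →
                  SameCell s xs xs → SameCell s ys ys → SameCell s xs ys
  near⇒SameCell s≤l xs ys near xx yy i =
    let wx = proj₁ (xx i) ; wy = proj₁ (yy i) in
    wx , wy , near⇒quot≡ s≤l (lookup xs i) (lookup ys i) (near i) wx wy

  cell-injective : ∀ {s} → s ≤ l → ∀ x y → quot s x ≡ quot s y → rem s x ≡ rem s y → x ≡ y
  cell-injective {s} s≤l x y q r = +-cancelʳ-≡ s x y
    (trans (sym (cell-spec x s≤l)) (trans (cong₂ (λ a b → a * suc l + b) q r) (cell-spec y s≤l)))

  -- Inside a cell the quotients are fixed, so a point is determined by its `d` remainders, each one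
  -- of `suc l` values.
  SameCell-class≤ : ∀ {s} → s ≤ l → ∀ {A : Set} {d} (pos : A → Vec ℕ d) →
    (∀ {u v} → (∀ i → lookup (pos u) i ≡ lookup (pos v) i) → u ≡ v) →
    ∀ v xs → Unique xs → (∀ {u} → u ∈ xs → SameCell s (pos v) (pos u)) → length xs ≤ suc l ^ d
  SameCell-class≤ {s} s≤l {A} {d} pos inj v xs uniq same = Unique⇒length≤ (Fin.funToFin ∘ residue) xs uniq
    λ {a} {b} a∈ b∈ eq → inj λ i → cell-injective s≤l _ _
      (trans (sym (proj₂ (proj₂ (same a∈ i)))) (proj₂ (proj₂ (same b∈ i))))
      (fromℕ<-injective _ _ (s≤s (rem≤ (lookup (pos a) i) s≤l)) (s≤s (rem≤ (lookup (pos b) i) s≤l))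
        (funToFin-injective (residue a) (residue b) eq i))
    where
    residue : A → Fin d → Fin (suc l)
    residue u i = Fin.fromℕ< (s≤s (rem≤ (lookup (pos u) i) s≤l))

  module _ (J : ℕ) (L≡J*w : suc l ≡ J * w) where

    shift≤ : ∀ {j} → j < J → j * w ≤ l
    shift≤ {j} j<J = ≤-pred (≤-trans (*-monoˡ-< w {{w≢0 w L≡J*w}} j<J) (≤-reflexive (sym L≡J*w)))
      where
      w≢0 : ∀ w → suc l ≡ J * w → NonZero w
      w≢0 zero    eq = contradiction (trans eq (*-zeroʳ J)) λ ()
      w≢0 (suc w) eq = _

    -- The two displaced positions differ by (j - i) w, which lies between w and (J - 1) w; two
    -- positions whose residues modulo J w are both below w differ by less than w or by more than (J
    -- - 1) w.
    margin-once-< : ∀ x {i j} → i < j → j < J → rem (i * w) x < w → ¬ rem (j * w) x < w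
    margin-once-< x {i} {j} i<j j<J ri rj with ≤-<-connex (quot (j * w) x) (quot (i * w) x)
    -- No cell boundary is passed: the positions would be less than `w` apart.
    ... | inj₁ qj≤qi = <-irrefl refl (begin-strict
      x + j * w                                      ≡⟨ cell-spec x (shift≤ j<J) ⟨
      quot (j * w) x * suc l + rem (j * w) x         <⟨ +-mono-≤-< (*-monoˡ-≤ (suc l) qj≤qi) rj ⟩
      quot (i * w) x * suc l + w                     ≤⟨ +-monoˡ-≤ w (m≤m+n _ (rem (i * w) x)) ⟩
      quot (i * w) x * suc l + rem (i * w) x + w     ≡⟨ cong (_+ w) (cell-spec x (shift≤ (<-trans i<j j<J))) ⟩
      x + i * w + w                                  ≡⟨ shuffle x (i * w) w ⟩
      x + suc i * w                                  ≤⟨ +-monoʳ-≤ x (*-monoˡ-≤ w i<j) ⟩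
      x + j * w                                      ∎)
      where
      open ≤-Reasoning
      shuffle : ∀ x a w → x + a + w ≡ x + (w + a)
      shuffle = solve-∀
    -- A boundary is passed: getting from one margin to the next takes more than (J - 1) w.
    ... | inj₂ qi<qj = <-irrefl refl (begin-strict
      x + j * w                                      ≤⟨ +-monoˡ-≤ (j * w) (m≤m+n x (i * w)) ⟩
      x + i * w + j * w                              ≡⟨ cong (_+ j * w) (cell-spec x (shift≤ (<-trans i<j j<J))) ⟨
      quot (i * w) x * suc l + rem (i * w) x + j * w <⟨ +-monoˡ-< (j * w) (+-monoʳ-< (quot (i * w) x * suc l) ri) ⟩
      quot (i * w) x * suc l + w + j * w             ≡⟨ +-assoc (quot (i * w) x * suc l) w (j * w) ⟩
      quot (i * w) x * suc l + suc j * w             ≤⟨ +-monoʳ-≤ (quot (i * w) x * suc l) (*-monoˡ-≤ w j<J) ⟩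
      quot (i * w) x * suc l + J * w                 ≡⟨ cong (quot (i * w) x * suc l +_) L≡J*w ⟨
      quot (i * w) x * suc l + suc l                 ≡⟨ +-comm (quot (i * w) x * suc l) (suc l) ⟩
      suc (quot (i * w) x) * suc l                   ≤⟨ *-monoˡ-≤ (suc l) qi<qj ⟩
      quot (j * w) x * suc l                         ≤⟨ m≤m+n _ (rem (j * w) x) ⟩
      quot (j * w) x * suc l + rem (j * w) x         ≡⟨ cell-spec x (shift≤ j<J) ⟩
      x + j * w                                      ∎)
      where open ≤-Reasoning

    interior≡false⇒margin : ∀ s x → interior s x ≡ false → rem s x < w
    interior≡false⇒margin s x eq = ≰⇒> λ w≤ → subst T eq (≤⇒≤ᵇ w≤)

    margin-once : ∀ x i j → i ∈ upTo J → j ∈ upTo J →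
                  interior (i * w) x ≡ false → interior (j * w) x ≡ false → i ≡ j
    margin-once x i j i∈ j∈ ¬i ¬j with <-cmp i j
    ... | tri< i<j _ _ = ⊥-elim (margin-once-< x i<j (∈-upTo⁻ j∈)
                                   (interior≡false⇒margin (i * w) x ¬i) (interior≡false⇒margin (j * w) x ¬j))
    ... | tri≈ _ eq _  = eq
    ... | tri> _ _ j<i = ⊥-elim (margin-once-< x j<i (∈-upTo⁻ i∈)
                                   (interior≡false⇒margin (j * w) x ¬j) (interior≡false⇒margin (i * w) x ¬i))

    -- Induction on the dimension, each coordinate costing one displacement. The loss `d · a` stands
    -- on the right to avoid the subtraction J - d.
    ∑-sameCell : ∀ {a} → 0ℚ ℚ.≤ a → ∀ {d} (xs : Vec ℕ d) →
      J · a ℚ.≤ ∑ (upTo J) (λ j → if sameCell (j * w) d (toList xs) (toList xs) then a else 0ℚ) ℚ.+ d · a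
    ∑-sameCell {a} 0≤a [] = ℚ.≤-reflexive (begin
      J · a                             ≡⟨ cong (_· a) (length-upTo J) ⟨
      length (upTo J) · a               ≡⟨ ∑-const (upTo J) a ⟨
      ∑ (upTo J) (λ _ → a)              ≡⟨ ℚ.+-identityʳ _ ⟨
      ∑ (upTo J) (λ _ → a) ℚ.+ 0ℚ       ∎)
      where open ≡-Reasoning
    ∑-sameCell {a} 0≤a {suc d} (x ∷ xs) = begin
      J · a
        ≤⟨ ∑-sameCell 0≤a xs ⟩
      ∑ (upTo J) (λ j → if rest j then a else 0ℚ) ℚ.+ d · a
        ≤⟨ ℚ.+-monoˡ-≤ (d · a) (∑-at-most-one-failure (λ j → interior (j * w) x) rest 0≤a
             (upTo J) (Unique.upTo⁺ J) (margin-once x)) ⟩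
      ∑ (upTo J) (λ j → if interior (j * w) x ∧ rest j then a else 0ℚ) ℚ.+ a ℚ.+ d · a
        ≡⟨ cong (λ z → z ℚ.+ a ℚ.+ d · a) (∑-cong (upTo J) λ j _ →
             cong (λ b → if b then a else 0ℚ) (sameCell-diagonal (j * w) d x (toList xs))) ⟨
      total ℚ.+ a ℚ.+ d · a
        ≡⟨ ℚ.+-assoc total a (d · a) ⟩
      total ℚ.+ (a ℚ.+ d · a) ∎
      where
      open ℚ.≤-Reasoning
      rest : ℕ → Bool
      rest j = sameCell (j * w) d (toList xs) (toList xs)
      total : ℚ
      total = ∑ (upTo J) (λ j → if sameCell (j * w) (suc d) (x ∷ toList xs) (x ∷ toList xs) then a else 0ℚ)

-- The program

-- The counter starts at suc i so that it reaches 0 when bit i has just been stored.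
bitAt : List Bool → ℕ → Bool
bitAt bs i = proj₂ (foldl (λ a b → caseNat a (λ j → j , b) (proj₁ a)) (suc i , false) bs)

bitAt-tabulate : ∀ {m} (f : Fin m → Bool) u → bitAt (List.tabulate f) (toℕ u) ≡ f u
bitAt-tabulate f u = go f u false
  where
  read : ℕ × Bool → Bool → ℕ × Bool
  read a b = caseNat a (λ j → j , b) (proj₁ a)
  stop : ∀ c bs → foldl read (0 , c) bs ≡ (0 , c)
  stop c []       = refl
  stop c (b ∷ bs) = stop c bs
  go : ∀ {m} (f : Fin m → Bool) u c → proj₂ (foldl read (suc (toℕ u) , c) (List.tabulate f)) ≡ f u
  go f zero    c = cong proj₂ (stop (f zero) (List.tabulate (f ∘ suc)))
  go f (suc u) c = go (f ∘ suc) u (f zero)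

bitAtₚ : ∀ {f : ⟦ σ ⟧ → List Bool} {g : ⟦ σ ⟧ → ℕ} → PolyTime σ (`list `bool) f → PolyTime σ `nat g →
         PolyTime σ `bool (λ x → bitAt (f x) (g x))
bitAtₚ {σ} p q = pairₚ p (pairₚ (pairₚ (sucₚ q) falseₚ) idₚ) ⨾ₚ
  foldlₚ step (var ⊕ var ⊗ con 1) (additive-growth step (con 1) grow) ⨾ₚ sndₚ
  where
  step : PolyTime (`bool `× (`nat `× `bool) `× σ) (`nat `× `bool)
                  (λ (b , a , s) → caseNat a (λ j → j , b) (proj₁ a))
  step = caseNatₚ (sndₚ ⨾ₚ fstₚ ⨾ₚ fstₚ) (sndₚ ⨾ₚ fstₚ) (pairₚ fstₚ (sndₚ ⨾ₚ fstₚ))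
  grow : ∀ b (a : ℕ × Bool) (s : ⟦ σ ⟧) →
         size (`nat `× `bool) (caseNat a (λ j → j , b) (proj₁ a)) ≤ proj₁ a + 1 + 1
  grow b (zero  , c) s = s≤s z≤n
  grow b (suc j , c) s = ≤-trans (n≤1+n _) (m≤m+n _ _)

eqᵇₚ : ∀ {f g : ⟦ σ ⟧ → ℕ} → PolyTime σ `nat f → PolyTime σ `nat g →
       PolyTime σ `bool (λ x → eqᵇ (f x) (g x))
eqᵇₚ p q = andₚ (leqₚ p q) (leqₚ q p)

module _ (w l : ℕ) where
  open Cells w l

  cellₚ : ∀ s {f : ⟦ σ ⟧ → ℕ} → PolyTime σ `nat f → PolyTime σ (`nat `× `nat) (λ x → cell s (f x))
  cellₚ {σ} s p = pairₚ (p ⨾ₚ unaryₚ) (pairₚ (pairₚ (natₚ 0) (natₚ s)) idₚ) ⨾ₚ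
    foldlₚ step (var ⊕ var ⊗ con 1) (additive-growth step (con 1) grow)
    where
    step : PolyTime (`bool `× (`nat `× `nat) `× σ) (`nat `× `nat) (λ (_ , a , _) → tick a)
    step = ifₚ (leqₚ (natₚ l) (acc ⨾ₚ sndₚ)) (pairₚ (sucₚ (acc ⨾ₚ fstₚ)) (natₚ 0))
               (pairₚ (acc ⨾ₚ fstₚ) (sucₚ (acc ⨾ₚ sndₚ)))
      where
      acc : PolyTime (`bool `× (`nat `× `nat) `× σ) (`nat `× `nat) (λ (_ , a , _) → a)
      acc = sndₚ ⨾ₚ fstₚ
    grow : ∀ (b : Bool) a (s : ⟦ σ ⟧) → size (`nat `× `nat) (tick a) ≤ proj₁ a + proj₂ a + 1
    grow b (q , r) s with l ≤ᵇ r
    ... | true  = ≤-trans (≤-reflexive (cong suc (+-identityʳ q)))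
                    (≤-trans (s≤s (m≤m+n q r)) (≤-reflexive (+-comm 1 (q + r))))
    ... | false = ≤-reflexive (trans (+-suc q r) (+-comm 1 (q + r)))

  sameCellₚ : ∀ s d {f g : ⟦ σ ⟧ → List ℕ} → PolyTime σ (`list `nat) f → PolyTime σ (`list `nat) g →
              PolyTime σ `bool (λ x → sameCell s d (f x) (g x))
  sameCellₚ s zero    p q = trueₚ
  sameCellₚ s (suc d) p q =
    caseListₚ p falseₚ (caseListₚ (sndₚ ⨾ₚ sndₚ ⨾ₚ q) falseₚ
      (andₚ (leqₚ (natₚ w) (cellₚ s x ⨾ₚ sndₚ)) (andₚ (leqₚ (natₚ w) (cellₚ s y ⨾ₚ sndₚ))
        (andₚ (eqᵇₚ (cellₚ s x ⨾ₚ fstₚ) (cellₚ s y ⨾ₚ fstₚ))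
              (sameCellₚ s d (sndₚ ⨾ₚ sndₚ ⨾ₚ sndₚ ⨾ₚ fstₚ) (sndₚ ⨾ₚ fstₚ))))))
    where
    x : PolyTime (`nat `× `list `nat `× `nat `× `list `nat `× _) `nat (λ (_ , _ , x , _) → x)
    x = sndₚ ⨾ₚ sndₚ ⨾ₚ fstₚ
    y : PolyTime (`nat `× `list `nat `× `nat `× `list `nat `× _) `nat proj₁
    y = fstₚ

-- An encoded vertex does not contain its index, which is needed to recognise it and to read its
-- entry in the adjacency row of another vertex.
`item : Ty
`item = `nat `× `vertex

key : ⟦ `item ⟧ → ℕ
key = proj₁

coords : ⟦ `item ⟧ → List ℕ
coords x = proj₁ (proj₂ x)

wt : ⟦ `item ⟧ → ℚ
wt x = proj₁ (proj₂ (proj₂ x))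

adj : ⟦ `item ⟧ → ⟦ `item ⟧ → Bool
adj x y = bitAt (proj₂ (proj₂ (proj₂ x))) (key y)

wtₚ : PolyTime `item `weight wt
wtₚ = sndₚ ⨾ₚ sndₚ ⨾ₚ fstₚ

adjₚ : ∀ {f g : ⟦ σ ⟧ → ⟦ `item ⟧} → PolyTime σ `item f → PolyTime σ `item g →
       PolyTime σ `bool (λ x → adj (f x) (g x))
adjₚ p q = bitAtₚ (p ⨾ₚ sndₚ ⨾ₚ sndₚ ⨾ₚ sndₚ) (q ⨾ₚ fstₚ)

module Raw = Algorithm key adj wt

memberₚ : PolyTime (`item `× `list `item) `bool (λ (x , xs) → Raw.member x xs)
memberₚ = pairₚ sndₚ (pairₚ falseₚ fstₚ) ⨾ₚ
  foldrₚ {α = `bool} {σ = `item} (con 0)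
    (ifₚ (eqᵇₚ (sndₚ ⨾ₚ sndₚ ⨾ₚ fstₚ) (fstₚ ⨾ₚ fstₚ)) trueₚ (sndₚ ⨾ₚ fstₚ)) (λ _ _ _ → s≤s z≤n)

betterₚ : PolyTime ((`weight `× `list `item) `× (`weight `× `list `item)) (`weight `× `list `item)
                   (λ (p , q) → Raw.better p q)
betterₚ = ifₚ (leqwₚ (fstₚ ⨾ₚ fstₚ) (sndₚ ⨾ₚ fstₚ)) sndₚ fstₚ

avoidₚ : PolyTime (`item `× `list `item) (`list `item) (λ (x , xs) → Raw.avoid x xs)
avoidₚ = filterₚ (notₚ (adjₚ (sndₚ ⨾ₚ fstₚ) fstₚ)) sndₚ

extendₚ : PolyTime (`item `× `weight `× `list `item) (`weight `× `list `item) (λ (x , r) → Raw.extend x r)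
extendₚ = pairₚ (addₚ (fstₚ ⨾ₚ wtₚ) (sndₚ ⨾ₚ fstₚ)) (consₚ fstₚ (sndₚ ⨾ₚ sndₚ))

-- Each level contains two copies of the next, so the program is exponential in `k`, but `k` does
-- not depend on the input.
misₚ : ∀ k → PolyTime (`list `item) (`weight `× `list `item) (Raw.mis k)
misₚ zero    = pairₚ 0wₚ nilₚ
misₚ (suc k) = caseListₚ idₚ (pairₚ 0wₚ nilₚ)
  (pairₚ (sndₚ ⨾ₚ fstₚ ⨾ₚ misₚ k)
         (pairₚ fstₚ (pairₚ fstₚ (sndₚ ⨾ₚ fstₚ) ⨾ₚ avoidₚ ⨾ₚ misₚ k) ⨾ₚ extendₚ) ⨾ₚ betterₚ)

chooseₚ : ∀ k {same : ⟦ `item ⟧ → ⟦ `item ⟧ → Bool} →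
          PolyTime (`item `× `item) `bool (λ (x , y) → same x y) →
          PolyTime (`list `item) (`list (`bool `× `weight)) (Raw.choose k same)
chooseₚ k same = mapₚ
  (pairₚ (pairₚ fstₚ (filterₚ (pairₚ (sndₚ ⨾ₚ fstₚ) fstₚ ⨾ₚ same) sndₚ ⨾ₚ misₚ k ⨾ₚ sndₚ) ⨾ₚ memberₚ)
         (fstₚ ⨾ₚ wtₚ))
  idₚ

weigh : List (Bool × ℚ) → ℚ
weigh ps = ∑ ps (λ p → if proj₁ p then proj₂ p else 0ℚ)

weighₚ : PolyTime (`list (`bool `× `weight)) `weight weigh
weighₚ = pairₚ idₚ (pairₚ 0wₚ 0wₚ) ⨾ₚ
  foldrₚ {α = `weight} {σ = `weight} (con 0)
    (addₚ (ifₚ (fstₚ ⨾ₚ fstₚ) (fstₚ ⨾ₚ sndₚ) 0wₚ) (sndₚ ⨾ₚ fstₚ)) (λ _ _ _ → s≤s z≤n)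

argmaxₚ : ∀ {w : ⟦ τ ⟧ → ℚ} {s : ℕ → ⟦ σ ⟧ → ⟦ τ ⟧} → PolyTime τ `weight w → (∀ j → PolyTime σ τ (s j)) →
          ∀ j → PolyTime σ τ (λ x → argmax w (λ i → s i x) j)
argmaxₚ w s zero    = s zero
argmaxₚ w s (suc j) = ifₚ (leqwₚ (argmaxₚ w s j ⨾ₚ w) (s (suc j) ⨾ₚ w)) (s (suc j)) (argmaxₚ w s j)

-- Numbering the vertices

module _ {σ : Ty} where
  private
    V = ⟦ σ ⟧

  label : ℕ × List (ℕ × V) → V → ℕ × List (ℕ × V)
  label a v = suc (proj₁ a) , (proj₁ a , v) ∷ proj₂ a

  number : List V → List (ℕ × V)
  number vs = reverse (proj₂ (foldl label (0 , []) vs))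

  number-tabulate : ∀ {m} (f : Fin m → V) → number (List.tabulate f) ≡ List.tabulate (λ v → toℕ v , f v)
  number-tabulate f = trans (cong reverse (go 0 [] f)) (reverse-involutive _)
    where
    go : ∀ {m} k acc (f : Fin m → V) →
         proj₂ (foldl label (k , acc) (List.tabulate f)) ≡ List.tabulate (λ v → k + toℕ v , f v) ʳ++ acc
    go {zero}  k acc f = refl
    go {suc m} k acc f = trans (go (suc k) ((k , f zero) ∷ acc) (f ∘ suc))
      (cong₂ (λ xs i → xs ʳ++ ((i , f zero) ∷ acc))
        (tabulate-cong (λ v → cong (_, f (suc v)) (sym (+-suc k (toℕ v))))) (sym (+-identityʳ k)))

  -- Each round stores the counter, which is part of the accumulator, so `additive-growth` does not
  -- apply; instead `M` bounds every counter value.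
  size-label : ∀ M vs i acc → i + length vs ≤ M →
    size (`nat `× `list (`nat `× σ)) (foldl label (i , acc) vs) ≤
    M + (size (`list (`nat `× σ)) acc + length vs * M + size (`list σ) vs)
  size-label M []       i acc i≤ = +-mono-≤ (≤-trans (≤-reflexive (sym (+-identityʳ i))) i≤)
    (≤-trans (m≤m+n _ 0) (≤-trans (m≤m+n _ 0) ≤-refl))
  size-label M (v ∷ vs) i acc i≤ = ≤-trans
    (size-label M vs (suc i) ((i , v) ∷ acc) (≤-trans (≤-reflexive (sym (+-suc i (length vs)))) i≤))
    (+-monoʳ-≤ M (begin
      suc (i + a + b) + c + e    ≡⟨ shuffle i a b c e ⟩
      b + (i + c) + suc (a + e)  ≤⟨ +-monoˡ-≤ (suc (a + e)) (+-monoʳ-≤ b (+-monoˡ-≤ c (≤-trans (m≤m+n i _) i≤))) ⟩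
      b + (M + c) + suc (a + e)  ∎))
    where
    open ≤-Reasoning
    a = size σ v
    b = size (`list (`nat `× σ)) acc
    c = length vs * M
    e = size (`list σ) vs
    shuffle : ∀ i a b c e → suc (i + a + b) + c + e ≡ b + (i + c) + suc (a + e)
    shuffle = solve-∀

  numberₚ : PolyTime (`list σ) (`list (`nat `× σ)) number
  numberₚ = pairₚ idₚ (pairₚ (pairₚ (natₚ 0) nilₚ) (natₚ 0)) ⨾ₚ
    foldlₚ {α = `nat `× `list (`nat `× σ)} {σ = `nat}
      (pairₚ (sucₚ (sndₚ ⨾ₚ fstₚ ⨾ₚ fstₚ)) (consₚ (pairₚ (sndₚ ⨾ₚ fstₚ ⨾ₚ fstₚ) fstₚ) (sndₚ ⨾ₚ fstₚ ⨾ₚ sndₚ)))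
      (var ⊕ (var ⊕ var ⊗ var ⊕ var)) grow ⨾ₚ
    sndₚ ⨾ₚ reverseₚ
    where
    grow : ∀ vs (a : ℕ × List (ℕ × V)) s → size (`nat `× `list (`nat `× σ)) (foldl label a vs) ≤
           eval (var ⊕ (var ⊕ var ⊗ var ⊕ var))
                (size (`list σ) vs + (size (`nat `× `list (`nat `× σ)) a + s))
    grow vs (i , acc) s = ≤-trans
      (size-label n vs i acc (≤-trans (+-mono-≤ (≤-trans (m≤m+n i A) (m≤m+n (i + A) s)) (length≤size σ vs))
                                      (≤-reflexive (+-comm (i + A + s) (size (`list σ) vs)))))
      (+-monoʳ-≤ n (+-mono-≤ (+-mono-≤ (≤-trans (≤-trans (m≤n+m A i) (m≤m+n (i + A) s))
                                                (m≤n+m _ (size (`list σ) vs)))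
                                       (*-monoˡ-≤ n (≤-trans (length≤size σ vs) (m≤m+n _ _))))
                             (m≤m+n _ _)))
      where
      A = size (`list (`nat `× σ)) acc
      n = size (`list σ) vs + (i + A + s)

-- K bounds the number of vertices of a cell, and suc J is the number of displacements.
module Scheme (d w l J K : ℕ) where
  open Cells w l

  same : ℕ → ⟦ `item ⟧ → ⟦ `item ⟧ → Bool
  same j x y = sameCell (j * w) d (coords x) (coords y)

  scheme : ⟦ `network ⟧ → ⟦ `vertexSet ⟧
  scheme net = map proj₁ (argmax weigh (λ j → Raw.choose K (same j) (number (proj₂ net))) J)

  schemeₚ : PolyTime `network `vertexSet scheme
  schemeₚ = sndₚ ⨾ₚ numberₚ {`vertex} ⨾ₚ
    argmaxₚ weighₚ (λ j → chooseₚ K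
      (sameCellₚ w l (j * w) d (fstₚ ⨾ₚ sndₚ ⨾ₚ fstₚ) (sndₚ ⨾ₚ sndₚ ⨾ₚ fstₚ))) J ⨾ₚ
    mapₚ (fstₚ ⨾ₚ fstₚ) idₚ

-- The approximation guarantee

-- Iterated sums suit the averaging argument; cancelling a natural factor goes through
-- multiplication by a positive rational.
·≡* : ∀ n x → n · x ≡ (n · 1ℚ) ℚ.* x
·≡* zero    x = sym (ℚ.*-zeroˡ x)
·≡* (suc n) x = begin
  x ℚ.+ n · x                       ≡⟨ cong₂ ℚ._+_ (sym (ℚ.*-identityˡ x)) (·≡* n x) ⟩
  1ℚ ℚ.* x ℚ.+ (n · 1ℚ) ℚ.* x       ≡⟨ ℚ.*-distribʳ-+ x 1ℚ (n · 1ℚ) ⟨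
  (1ℚ ℚ.+ n · 1ℚ) ℚ.* x             ∎
  where open ≡-Reasoning

·1-nonNegative : ∀ n → NonNegative (n · 1ℚ)
·1-nonNegative zero    = _
·1-nonNegative (suc n) = ℚ.nonNeg+nonNeg⇒nonNeg 1ℚ (n · 1ℚ) {{·1-nonNegative n}}

·1-positive : ∀ n → Positive (suc n · 1ℚ)
·1-positive n = ℚ.pos+nonNeg⇒pos 1ℚ (n · 1ℚ) {{·1-nonNegative n}}

·-cancel-≤ : ∀ n {x y} → suc n · x ℚ.≤ suc n · y → x ℚ.≤ y
·-cancel-≤ n {x} {y} nx≤ny = ℚ.*-cancelˡ-≤-pos (suc n · 1ℚ) {{·1-positive n}}
  (subst₂ ℚ._≤_ (·≡* (suc n) x) (·≡* (suc n) y) nx≤ny)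

toℚᵘ-·1 : ∀ n → toℚᵘ (n · 1ℚ) ℚᵘ.≃ ℚᵘ.mkℚᵘ (ℤ.+ n) 0
toℚᵘ-·1 zero    = ℚᵘ.≃-refl
toℚᵘ-·1 (suc n) = ℚᵘ.≃-trans (ℚ.toℚᵘ-homo-+ 1ℚ (n · 1ℚ))
  (ℚᵘ.≃-trans (ℚᵘ.+-congʳ ℚᵘ.1ℚᵘ (toℚᵘ-·1 n))
    (ℚᵘ.*≡* (cong (λ z → (ℤ.+ 1 ℤ.+ z) ℤ.* ℤ.+ 1) (ℤ.*-identityʳ (ℤ.+ n)))))

-- Denominator times ε is the numerator, a positive integer.
1≤denominator*ε : ∀ ε → .{{Positive ε}} → 1ℚ ℚ.≤ suc (ℚ.denominator-1 ε) · ε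
1≤denominator*ε ε@(mkℚ ℤ.+[1+ p ] e _) = ℚ.toℚᵘ-cancel-≤ (begin
  ℚᵘ.1ℚᵘ                                             ≤⟨ ℚᵘ.*≤* (ℤ.+≤+ bound) ⟩
  ℚᵘ.mkℚᵘ (ℤ.+ suc e) 0 ℚᵘ.* toℚᵘ ε                  ≃⟨ ℚᵘ.*-congʳ (toℚᵘ-·1 (suc e)) ⟨
  toℚᵘ (suc e · 1ℚ) ℚᵘ.* toℚᵘ ε                      ≃⟨ ℚ.toℚᵘ-homo-* (suc e · 1ℚ) ε ⟨
  toℚᵘ ((suc e · 1ℚ) ℚ.* ε)                          ≡⟨ cong toℚᵘ (·≡* (suc e) ε) ⟨
  toℚᵘ (suc e · ε)                                   ∎)
  where
  open ℚᵘ.≤-Reasoning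
  bound : 1 * (1 * suc e) ≤ suc e * suc p * 1
  bound = ≤-trans (≤-reflexive (trans (*-identityˡ _) (*-identityˡ (suc e))))
            (≤-trans (m≤m*n (suc e) (suc p)) (≤-reflexive (sym (*-identityʳ _))))

-- With D = `suc d` and J = (q + 1) D, subtracting D W and cancelling D leaves q W ≤ (q + 1) B; then
-- 1 ≤ q ε gives q W ≤ q (1 + ε) B.
approximation-ratio : ∀ ε → {{_ : Positive ε}} → ∀ d {W B} → 0ℚ ℚ.≤ B →
  let q = suc (ℚ.denominator-1 ε) ; J = suc q * suc d in
  J · W ℚ.≤ J · B ℚ.+ suc d · W → 1/[1+ ε ] ℚ.* W ℚ.≤ B
approximation-ratio ε d {W} {B} 0≤B JW≤ = begin
  1/[1+ ε ] ℚ.* W                       ≤⟨ ℚ.*-monoˡ-≤-nonNeg 1/[1+ ε ] {{1/-nonNeg}} W≤ ⟩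
  1/[1+ ε ] ℚ.* ((1ℚ ℚ.+ ε) ℚ.* B)      ≡⟨ ℚ.*-assoc 1/[1+ ε ] (1ℚ ℚ.+ ε) B ⟨
  (1/[1+ ε ] ℚ.* (1ℚ ℚ.+ ε)) ℚ.* B      ≡⟨ cong (ℚ._* B) (ℚ.*-inverseˡ (1ℚ ℚ.+ ε) {{1+ε≢0}}) ⟩
  1ℚ ℚ.* B                              ≡⟨ ℚ.*-identityˡ B ⟩
  B                                     ∎
  where
  open ℚ.≤-Reasoning
  q = suc (ℚ.denominator-1 ε)
  D = suc d
  1+ε-pos : Positive (1ℚ ℚ.+ ε)
  1+ε-pos = ℚ.pos+pos⇒pos 1ℚ ε
  1+ε≢0 : ℚ.NonZero (1ℚ ℚ.+ ε)
  1+ε≢0 = ℚ.pos⇒nonZero (1ℚ ℚ.+ ε) {{1+ε-pos}}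
  1/-nonNeg : NonNegative 1/[1+ ε ]
  1/-nonNeg = ℚ.pos⇒nonNeg 1/[1+ ε ] {{ℚ.1/pos⇒pos (1ℚ ℚ.+ ε) {{1+ε-pos}}}}
  D·qW≤ : D · (q · W) ℚ.≤ D · (suc q · B)
  D·qW≤ = begin
    D · (q · W)          ≡⟨ ×-assocˡ W D q ⟩
    (D * q) · W          ≡⟨ cong (_· W) (*-comm D q) ⟩
    (q * D) · W          ≤⟨ cancel (D · W) (begin
                              D · W ℚ.+ (q * D) · W          ≡⟨ ×-homo-+ W D (q * D) ⟨
                              (suc q * D) · W                ≤⟨ JW≤ ⟩
                              (suc q * D) · B ℚ.+ D · W      ≡⟨ ℚ.+-comm _ (D · W) ⟩
                              D · W ℚ.+ (suc q * D) · B      ∎) ⟩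
    (suc q * D) · B      ≡⟨ cong (_· B) (*-comm (suc q) D) ⟩
    (D * suc q) · B      ≡⟨ ×-assocˡ B D (suc q) ⟨
    D · (suc q · B)      ∎
    where
    cancel : ∀ a {x y} → a ℚ.+ x ℚ.≤ a ℚ.+ y → x ℚ.≤ y
    cancel a {x} {y} le = subst₂ ℚ._≤_ (collapse x) (collapse y) (ℚ.+-monoʳ-≤ (ℚ.- a) le)
      where
      collapse : ∀ z → ℚ.- a ℚ.+ (a ℚ.+ z) ≡ z
      collapse z = trans (sym (ℚ.+-assoc (ℚ.- a) a z))
                     (trans (cong (ℚ._+ z) (ℚ.+-inverseˡ a)) (ℚ.+-identityˡ z))
  W≤ : W ℚ.≤ (1ℚ ℚ.+ ε) ℚ.* B
  W≤ = ·-cancel-≤ (ℚ.denominator-1 ε) (begin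
    q · W                               ≤⟨ ·-cancel-≤ d D·qW≤ ⟩
    B ℚ.+ q · B                         ≡⟨ cong (ℚ._+ q · B) (ℚ.*-identityˡ B) ⟨
    1ℚ ℚ.* B ℚ.+ q · B                  ≤⟨ ℚ.+-monoˡ-≤ (q · B)
                                             (ℚ.*-monoʳ-≤-nonNeg B {{ℚ.nonNegative 0≤B}} (1≤denominator*ε ε)) ⟩
    (q · ε) ℚ.* B ℚ.+ q · B             ≡⟨ cong (λ z → z ℚ.* B ℚ.+ q · B) (·≡* q ε) ⟩
    (q · 1ℚ) ℚ.* ε ℚ.* B ℚ.+ q · B      ≡⟨ cong (ℚ._+ q · B) (ℚ.*-assoc (q · 1ℚ) ε B) ⟩
    (q · 1ℚ) ℚ.* (ε ℚ.* B) ℚ.+ q · B    ≡⟨ cong (ℚ._+ q · B) (·≡* q (ε ℚ.* B)) ⟨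
    q · (ε ℚ.* B) ℚ.+ q · B             ≡⟨ ×-distrib-+ (ε ℚ.* B) B q ⟨
    q · (ε ℚ.* B ℚ.+ B)                 ≡⟨ cong (q ·_) (ℚ.+-comm (ε ℚ.* B) B) ⟩
    q · (B ℚ.+ ε ℚ.* B)                 ≡⟨ cong (λ z → q · (z ℚ.+ ε ℚ.* B)) (ℚ.*-identityˡ B) ⟨
    q · (1ℚ ℚ.* B ℚ.+ ε ℚ.* B)          ≡⟨ cong (q ·_) (ℚ.*-distribʳ-+ B 1ℚ ε) ⟨
    q · ((1ℚ ℚ.+ ε) ℚ.* B)              ∎)

∑-· : ∀ {A : Set} n (xs : List A) f → ∑ xs (λ x → n · f x) ≡ n · ∑ xs f
∑-· n []       f = sym (trans (·≡* n 0ℚ) (ℚ.*-zeroʳ (n · 1ℚ)))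
∑-· n (x ∷ xs) f = trans (cong (n · f x ℚ.+_) (∑-· n xs f)) (sym (×-distrib-+ (f x) (∑ xs f) n))

∑-map : ∀ {A B : Set} (h : A → B) xs f → ∑ (map h xs) f ≡ ∑ xs (f ∘ h)
∑-map h []       f = refl
∑-map h (x ∷ xs) f = cong (f (h x) ℚ.+_) (∑-map h xs f)

sum≡∑ : ∀ {m} (f : Fin m → ℚ) → sum f ≡ ∑ (allFin m) f
sum≡∑ f = go f (λ v → v)
  where
  go : ∀ {A : Set} {m} (f : A → ℚ) (h : Fin m → A) → sum (f ∘ h) ≡ ∑ (List.tabulate h) f
  go {m = zero}  f h = refl
  go {m = suc m} f h = cong (f (h zero) ℚ.+_) (go f (h ∘ suc))

toList-tabulate : ∀ {A : Set} {m} (f : Fin m → A) → toList (Vec.tabulate f) ≡ List.tabulate f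
toList-tabulate {m = zero}  f = refl
toList-tabulate {m = suc m} f = cong (f zero ∷_) (toList-tabulate (f ∘ suc))

argmax-cong : ∀ {X : Set} (w : X → ℚ) {s t : ℕ → X} → (∀ j → s j ≡ t j) → ∀ j → argmax w s j ≡ argmax w t j
argmax-cong w s≗t zero    = s≗t zero
argmax-cong w s≗t (suc j) rewrite s≗t (suc j) | argmax-cong w s≗t j = refl

coordinate≤manhattan : ∀ {d n} (x y : Grid d n) i → ∣ toℕ (lookup x i) - toℕ (lookup y i) ∣ ≤ manhattan x y
coordinate≤manhattan (a ∷ x) (b ∷ y) zero    = m≤m+n _ _
coordinate≤manhattan (a ∷ x) (b ∷ y) (suc i) = ≤-trans (coordinate≤manhattan x y i) (m≤n+m _ ∣ toℕ a - toℕ b ∣)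

-- Networks as instances of the search

module Network {d ω n : ℕ} (N : LoSNetwork d ω n) where
  open LoSNetwork N

  pos : Fin order → Vec ℕ d
  pos v = Vec.map (suc ∘ toℕ) (embed v)

  pos-injective : ∀ {u v} → (∀ i → lookup (pos u) i ≡ lookup (pos v) i) → u ≡ v
  pos-injective {u} {v} eq = injective (lookup-ext (embed u) (embed v) λ i →
    toℕ-injective (suc-injective (trans (sym (lookup-map i (suc ∘ toℕ) (embed u)))
      (trans (eq i) (lookup-map i (suc ∘ toℕ) (embed v))))))
    where
    lookup-ext : ∀ {k} (x y : Vec (Fin n) k) → (∀ i → lookup x i ≡ lookup y i) → x ≡ y
    lookup-ext []      []      eq = refl
    lookup-ext (a ∷ x) (b ∷ y) eq = cong₂ _∷_ (eq zero) (lookup-ext x y (eq ∘ suc))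

  edge⇒near : ∀ u v → T (edge u v) → ∀ i → ∣ lookup (pos u) i - lookup (pos v) i ∣ < ω
  edge⇒near u v uv i = ≤-<-trans
    (subst₂ (λ a b → ∣ a - b ∣ ≤ manhattan (embed u) (embed v))
      (sym (lookup-map i (suc ∘ toℕ) (embed u))) (sym (lookup-map i (suc ∘ toℕ) (embed v)))
      (coordinate≤manhattan (embed u) (embed v) i))
    (proj₂ (Equivalence.to (edge-iff u v) uv))

  -- Used to bound the size of the encoding by a polynomial in `n` alone.
  order≤ : order ≤ n ^ d
  order≤ = injective⇒≤ {f = λ v → Fin.funToFin (lookup (embed v))} λ {u} {v} eq →
    pos-injective λ i → trans (lookup-map i (suc ∘ toℕ) (embed u))
      (trans (cong (suc ∘ toℕ) (funToFin-injective (lookup (embed u)) (lookup (embed v)) eq i))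
        (sym (lookup-map i (suc ∘ toℕ) (embed v))))

  V : List (Fin order)
  V = allFin order

  item : Fin order → ⟦ `item ⟧
  item v = toℕ v , toList (pos v) , weight v , List.tabulate (edge v)

  number-encode : number {`vertex} (proj₂ (encode N)) ≡ map item V
  number-encode = trans (number-tabulate {`vertex} _) (sym (map-tabulate (λ v → v) item))

  weight≥0 : ∀ v → 0ℚ ℚ.≤ weight v
  weight≥0 v = ℚ.nonNegative⁻¹ (weight v) {{ℚ.pos⇒nonNeg (weight v) {{weight-pos v}}}}

  open Algorithm toℕ edge weight public
  open Correctness toℕ-injective edge-sym edge-irr weight≥0 public

  lookup-independent : ∀ S → Independent graph S → IndependentSet (lookup S)
  lookup-independent S ind u v Su Sv = ¬T⇒≡false
    (ind u v (lookup⇒[]= u S (T⇒≡true Su)) (lookup⇒[]= v S (T⇒≡true Sv)))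

  tabulate-independent : ∀ P → IndependentSet P → Independent graph (Vec.tabulate P)
  tabulate-independent P ind u v u∈ v∈ uv = subst T (ind u v (holds u∈) (holds v∈)) uv
    where
    holds : ∀ {v} → Vec.tabulate P Vec.[ v ]= true → T (P v)
    holds {v} v∈ = subst T (trans (sym ([]=⇒lookup v∈)) (lookup∘tabulate P v)) _

  totalWeight-∑ : ∀ S → totalWeight graph S ≡ ∑ V (λ v → if lookup S v then weight v else 0ℚ)
  totalWeight-∑ S = sum≡∑ (λ v → if lookup S v then weight v else 0ℚ)

  totalWeight-tabulate : ∀ P → totalWeight graph (Vec.tabulate P) ≡ ∑ V (λ v → if P v then weight v else 0ℚ)
  totalWeight-tabulate P = trans (totalWeight-∑ (Vec.tabulate P))
    (∑-cong V λ v _ → cong (λ b → if b then weight v else 0ℚ) (lookup∘tabulate P v))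

  -- The guarantee refers to an actual optimum. The same search with depth `order` on all vertices
  -- constructs one; it occurs only in the proof, so its running time does not matter.
  optimal : Fin order → Bool
  optimal v = member v (proj₂ (mis order V))

  optimal-independent : IndependentSet optimal
  optimal-independent u v u∈ v∈ = mis-independent order V (member⇒∈ u _ u∈) (member⇒∈ v _ v∈)

  optimal-maximum : MaximumIndependent graph (Vec.tabulate optimal)
  optimal-maximum = tabulate-independent optimal optimal-independent , λ S ind → begin
    totalWeight graph S                                    ≡⟨ totalWeight-∑ S ⟩
    ∑ V (λ v → if lookup S v then weight v else 0ℚ)        ≤⟨ mis-maximum order V (≤-reflexive (length-tabulate _))
                                                                (lookup S) (lookup-independent S ind) ⟩
    proj₁ (mis order V)                                    ≡⟨ mis-weight order V (Unique.allFin⁺ order) ⟩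
    ∑ V (λ v → if optimal v then weight v else 0ℚ)         ≡⟨ totalWeight-tabulate optimal ⟨
    totalWeight graph (Vec.tabulate optimal)               ∎
    where open ℚ.≤-Reasoning

-- Size of the encoded network

size-tabulate : ∀ σ {m b} (f : Fin m → ⟦ σ ⟧) → (∀ v → size σ (f v) ≤ b) →
                size (`list σ) (List.tabulate f) ≤ m * suc b
size-tabulate σ {zero}  f f≤ = z≤n
size-tabulate σ {suc m} f f≤ = s≤s (+-mono-≤ (f≤ zero) (size-tabulate σ (f ∘ suc) (f≤ ∘ suc)))

var^ : ℕ → Poly
var^ zero    = con 1
var^ (suc k) = var ⊗ var^ k

eval-var^ : ∀ k n → eval (var^ k) n ≡ n ^ k
eval-var^ zero    n = refl
eval-var^ (suc k) n = cong (n *_) (eval-var^ k n)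

-- Besides `n`, each of at most `n ^ d` vertices has a list cell, `d` coordinates of at most n with
-- their cells, a weight, and a row of at most `n ^ d` bits that count 2 each with their cells.
encodingSize : ℕ → Poly
encodingSize d = var ⊕ var^ d ⊗ (con 1 ⊕ (con d ⊗ (con 1 ⊕ var) ⊕ (con 1 ⊕ var^ d ⊗ con 2)))

size-encode : ∀ {d ω n} (N : LoSNetwork d ω n) → size `network (encode N) ≤ eval (encodingSize d) n
size-encode {d} {ω} {n} N = +-monoʳ-≤ n (≤-trans
  (size-tabulate `vertex _ λ v → +-mono-≤ (size-coords (embed v)) (s≤s (≤-trans
    (size-tabulate `bool (edge v) (λ _ → ≤-refl)) (*-monoˡ-≤ 2 order≤′))))
  (*-monoˡ-≤ _ order≤′))
  where
  open LoSNetwork N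
  order≤′ : order ≤ eval (var^ d) n
  order≤′ = ≤-trans (Network.order≤ N) (≤-reflexive (sym (eval-var^ d n)))
  size-coords : ∀ {d} (x : Grid d n) → size (`list `nat) (toList (Vec.map (λ i → suc (toℕ i)) x)) ≤ d * suc n
  size-coords []      = z≤n
  size-coords (a ∷ x) = s≤s (+-mono-≤ (toℕ<n a) (size-coords x))

-- The scheme on a given network

module _ (d w J : ℕ) {n} (N : LoSNetwork d (suc w) n) where
  private
    ω = suc w
    -- Chosen so that `suc l` reduces to `suc J * ω`; the equation between cell length and
    -- displacements is then `refl`.
    l = w + J * ω
    K = suc l ^ d
  open Network N
  open LoSNetwork N using (order; graph; edge; weight)
  open Cells ω l
  open Scheme d ω l J K using (scheme)

  near : ℕ → Fin order → Fin order → Bool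
  near j u v = sameCell (j * ω) d (toList (pos u)) (toList (pos v))

  near⁻ : ∀ j u v → T (near j u v) → SameCell (j * ω) (pos u) (pos v)
  near⁻ j u v = sameCell⇒SameCell (j * ω) (pos u) (pos v)

  near⁺ : ∀ j u v → SameCell (j * ω) (pos u) (pos v) → T (near j u v)
  near⁺ j u v = SameCell⇒sameCell (j * ω) (pos u) (pos v)

  near-sym : ∀ j u v → T (near j u v) → T (near j v u)
  near-sym j u v uv = near⁺ j v u λ i → let a , b , eq = near⁻ j u v uv i in b , a , sym eq

  near-trans : ∀ j u v w → T (near j u v) → T (near j v w) → T (near j u w)
  near-trans j u v w uv vw = near⁺ j u w λ i →
    let a , _ , eq = near⁻ j u v uv i ; _ , c , eq′ = near⁻ j v w vw i in a , c , trans eq eq′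

  module At {j} (j<J : j < suc J) = Shifted (near j) (near-sym j) (near-trans j)
    (λ u v uv uu vv → near⁺ j u v (near⇒SameCell (shift≤ (suc J) refl j<J) (pos u) (pos v)
       (edge⇒near u v uv) (near⁻ j u u uu) (near⁻ j v v vv)))
    V (Unique.allFin⁺ order) K
    (λ v → SameCell-class≤ (shift≤ (suc J) refl j<J) pos pos-injective v (filterᵇ (near j v) V)
       (Unique.filter⁺ (T? ∘ near j v) (Unique.allFin⁺ order))
       (λ {u} u∈ → near⁻ j v u (proj₂ (∈-filterᵇ⁻ (near j v) V u∈))))

  value : ℕ → ℚ
  value j = ∑ V (λ v → if chosen K (near j) V v then weight v else 0ℚ)

  candidate : ℕ → List (Bool × ℚ)
  candidate j = choose K (near j) V

  weigh-candidate : ∀ j → weigh (candidate j) ≡ value j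
  weigh-candidate j = ∑-map (λ v → chosen K (near j) V v , weight v) V (λ p → if proj₁ p then proj₂ p else 0ℚ)

  map-candidate : ∀ j → map proj₁ (candidate j) ≡ encodeSet (Vec.tabulate (chosen K (near j) V))
  map-candidate j = begin
    map proj₁ (candidate j)                          ≡⟨ map-∘ V ⟨
    map (chosen K (near j) V) V                      ≡⟨ map-tabulate (λ v → v) (chosen K (near j) V) ⟩
    List.tabulate (chosen K (near j) V)              ≡⟨ toList-tabulate (chosen K (near j) V) ⟨
    toList (Vec.tabulate (chosen K (near j) V))      ∎
    where open ≡-Reasoning

  scheme-candidate : scheme (encode N) ≡ map proj₁ (argmax weigh candidate J)
  scheme-candidate = trans
    (cong (λ xs → map proj₁ (argmax weigh (λ j → Raw.choose K (Scheme.same d ω l J K j) xs) J)) number-encode)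
    (cong (map proj₁) (argmax-cong weigh (λ j → Naturality.choose-map item {toℕ} {edge} {weight} {key} {adj} {wt}
      (λ _ → refl) (λ u v → bitAt-tabulate (edge u) v) (λ _ → refl) K (λ _ _ → refl) V) J))

  best : ∃ λ i → i ≤ J × argmax weigh candidate J ≡ candidate i
  best = argmax-attained weigh candidate J

  value≤best : ∀ {j} → j < suc J → value j ℚ.≤ value (proj₁ best)
  value≤best {j} (s≤s j≤J) = begin
    value j                               ≡⟨ weigh-candidate j ⟨
    weigh (candidate j)                   ≤⟨ argmax-max weigh candidate J j≤J ⟩
    weigh (argmax weigh candidate J)      ≡⟨ cong weigh (proj₂ (proj₂ best)) ⟩
    weigh (candidate (proj₁ best))        ≡⟨ weigh-candidate (proj₁ best) ⟩
    value (proj₁ best)                    ∎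
    where open ℚ.≤-Reasoning

  -- Averaging over the displacements: each coordinate of each vertex is in a margin at most once.
  averaging : ∀ P → IndependentSet P → let W = ∑ V (λ v → if P v then weight v else 0ℚ) in
    suc J · W ℚ.≤ suc J · value (proj₁ best) ℚ.+ d · W
  averaging P ind = begin
    suc J · ∑ V a
      ≡⟨ ∑-· (suc J) V a ⟨
    ∑ V (λ v → suc J · a v)
      ≤⟨ ∑-mono V (λ v _ → ∑-sameCell (suc J) refl (if-nonNeg (P v) (weight≥0 v)) (pos v)) ⟩
    ∑ V (λ v → ∑ (upTo (suc J)) (λ j → if near j v v then a v else 0ℚ) ℚ.+ d · a v)
      ≡⟨ ∑-+ V (λ v → ∑ (upTo (suc J)) (λ j → if near j v v then a v else 0ℚ)) (λ v → d · a v) ⟩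
    ∑ V (λ v → ∑ (upTo (suc J)) (λ j → if near j v v then a v else 0ℚ)) ℚ.+ ∑ V (λ v → d · a v)
      ≡⟨ cong₂ ℚ._+_ (∑-swap V (upTo (suc J)) (λ v j → if near j v v then a v else 0ℚ)) (∑-· d V a) ⟩
    ∑ (upTo (suc J)) (λ j → ∑ V (λ v → if near j v v then a v else 0ℚ)) ℚ.+ d · ∑ V a
      ≤⟨ ℚ.+-monoˡ-≤ (d · ∑ V a) (∑-mono (upTo (suc J)) λ j j∈ →
           ℚ.≤-trans (At.chosen-weight (∈-upTo⁻ j∈) P ind) (value≤best (∈-upTo⁻ j∈))) ⟩
    ∑ (upTo (suc J)) (λ _ → value (proj₁ best)) ℚ.+ d · ∑ V a
      ≡⟨ cong (ℚ._+ d · ∑ V a) (trans (∑-const (upTo (suc J)) (value (proj₁ best)))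
                                      (cong (_· value (proj₁ best)) (length-upTo (suc J)))) ⟩
    suc J · value (proj₁ best) ℚ.+ d · ∑ V a ∎
    where
    open ℚ.≤-Reasoning
    a : Fin order → ℚ
    a v = if P v then weight v else 0ℚ

  selected : Fin order → Bool
  selected = chosen K (near (proj₁ best)) V

  solution : Subset order
  solution = Vec.tabulate selected

  scheme-solution : scheme (encode N) ≡ encodeSet solution
  scheme-solution = trans scheme-candidate
    (trans (cong (map proj₁) (proj₂ (proj₂ best))) (map-candidate (proj₁ best)))

  solution-independent : Independent graph solution
  solution-independent = tabulate-independent selected (At.chosen-independent (s≤s (proj₁ (proj₂ best))))

solution-approximation : ∀ d w ε → {{_ : Positive ε}} → ∀ {n} (N : LoSNetwork (suc d) (suc w) n) →
  Approximation (LoSNetwork.graph N) ε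
    (solution (suc d) w (d + suc (ℚ.denominator-1 ε) * suc d) N)
solution-approximation d w ε N =
    solution-independent (suc d) w J N
  , Vec.tabulate optimal , optimal-maximum
  , subst₂ (λ W B → 1/[1+ ε ] ℚ.* W ℚ.≤ B)
      (sym (totalWeight-tabulate optimal)) (sym (totalWeight-tabulate (selected (suc d) w J N)))
      (approximation-ratio ε d
        (∑-nonNeg V (λ v → if-nonNeg (selected (suc d) w J N v) (weight≥0 v)))
        (averaging (suc d) w J N optimal optimal-independent))
  where
  open Network N
  -- `suc J` reduces to `suc q * suc d` with q the denominator of ε, the number of displacements in
  -- `approximation-ratio`.
  J = d + suc (ℚ.denominator-1 ε) * suc d

theorem8 : ∀ (d ω : ℕ) → 2 ≤ d → 2 < ω →
    ∀ (ε : ℚ) → {{_ : Positive ε}} →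
    Σ[ A ∈ (`network ⇒ `vertexSet) ]
    Σ[ c ∈ ℕ ] Σ[ k ∈ ℕ ]
    (∀ (n : ℕ) (N : LoSNetwork d ω n) →
    Σ[ S ∈ Subset (LoSNetwork.order N) ] Σ[ t ∈ ℕ ]
    (A ⊢ encode N ⇓ encodeSet S ∣ t)
    × (t ≤ c * n ^ k + c)
    × Approximation (LoSNetwork.graph N) ε S)
theorem8 d@(suc d′) ω@(suc w) _ _ ε =
  -- The program and the constants are fixed here by `d`, `ω` and `ε`, before any `n` or network is
  -- given.
  let c , k , within = runs-within schemeₚ (encodingSize d) in
  prog schemeₚ , c , k , λ n N →
    let t , r , t≤ = within n (encode N) (size-encode N) in
    solution d w J N , t , subst (λ y → prog schemeₚ ⊢ encode N ⇓ y ∣ t) (scheme-solution d w J N) r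
      , t≤ , solution-approximation d′ w ε N
  where
  J = d′ + suc (ℚ.denominator-1 ε) * d
  open Scheme d ω (w + J * ω) J (suc (w + J * ω) ^ d) using (schemeₚ)
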